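{- Let $G$ be a graph. The following are equivalent: (a1) $M_1(G)$ is a non-trivial matroid and $G$ is a cacti-graph; (a2) for every component $A$ of $G$, the edge set $E(A)$ is an equivalence class of the relation $\sim$ of $M_1(G)$.
   Context: Graphs are finite, may have loops and parallel edges, and have no isolated vertices. A leaf is a vertex incident to exactly one edge, which is not a loop. A cacti-graph is a graph with no isolated vertices, no leaves, and no component that is a cycle. For $X\subseteq E(G)$, $G\langle X\rangle$ is the subgraph with edge set $X$ and vertex set the vertices incident to $X$. $M_1(G)$ (the bicircular matroid) is the matroid on $E(G)$ whose circuits are the inclusion-minimal members of $\{C\subseteq E(G):C\neq\emptyset,\ |C|=|V(G\langle C\rangle)|+1\}$. A matroid is non-trivial if it has at least one circuit and at least one cocircuit. For a matroid $M$ on $E$ with set of loops $L$ and set of coloops $L^*$ (elements in no circuit), the relation $\sim$ on $E\setminus(L\cup L^*)$ is defined by $a\sim b$ iff $a=b$ or $a,b$ lie in a common circuit; it is an equivalence relation. -}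

module Defs where

open import Data.Empty using (⊥-elim)
open import Data.Fin using (Fin)
import Data.Fin.Properties as Fin
open import Data.Fin.Subset
  using (Subset; _∈_; _⊆_; _⊂_; _∪_; _∩_; _-_; ∁; ∣_∣; ⁅_⁆; Nonempty)
open import Data.Fin.Subset.Induction using (⊂-wellFounded)
open import Data.Fin.Subset.Properties
open import Data.Bool using (true; false)
import Data.Bool.Properties as Bool
open import Data.List using (List; []; _∷_)
import Data.List.Membership.Propositional as List
open import Data.List.Relation.Unary.All using (All)
open import Data.List.Relation.Unary.Unique.Propositional using (Unique)
open import Data.Nat using (ℕ; suc; _+_; _≤_; _<_; z≤n; s≤s; s≤s⁻¹; NonZero)
import Data.Nat.Properties as ℕ
open import Data.Product using (Σ; ∃; ∃-syntax; _×_; _,_; proj₁; proj₂)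
open import Data.Sum using (_⊎_; inj₁; inj₂)
import Data.Sum as Sum
open import Data.Vec using ([]; _∷_; tabulate)
import Data.Vec.Properties as Vec
open import Function using (_⇔_)
open import Induction.WellFounded using (Acc; acc)
open import Relation.Binary.PropositionalEquality
  using (_≡_; _≢_; refl; sym; trans; cong; subst)
open import Relation.Nullary using (¬_; Dec; yes; no; does; _×-dec_; _⊎-dec_; ¬?)
open import Relation.Nullary.Decidable using (map′; decidable-stable)
open import Relation.Unary using (Pred; Decidable)
open import Level using (0ℓ)

------------------------------------------------------------------------
-- Finite sets

Minimal : ∀ {m} → Pred (Subset m) 0ℓ → Pred (Subset m) 0ℓ
Minimal P C = P C × (∀ {D} → P D → D ⊆ C → D ≡ C)

_≟ˢ_ : ∀ {m} (X Y : Subset m) → Dec (X ≡ Y)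
_≟ˢ_ = Vec.≡-dec Bool._≟_

module _ {m} {P : Pred (Subset m) 0ℓ} (P? : Decidable P) where

  private
    smaller? : ∀ C → Dec (∃[ D ] P D × D ⊆ C × D ≢ C)
    smaller? C = anySubset? λ D → P? D ×-dec (D ⊆? C) ×-dec ¬? (D ≟ˢ C)

    isMinimal : ∀ {C} → P C → ¬ (∃[ D ] P D × D ⊆ C × D ≢ C) → Minimal P C
    isMinimal PC none = PC , λ {D} PD D⊆C →
      decidable-stable (D ≟ˢ _) (λ D≢C → none (D , PD , D⊆C , D≢C))

  minimal? : Decidable (Minimal P)
  minimal? C = map′
    (λ (PC , none) → isMinimal PC none)
    (λ (PC , least) → PC , λ (D , PD , D⊆C , D≢C) → D≢C (least PD D⊆C))
    (P? C ×-dec ¬? (smaller? C))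

  minimal-below : ∀ {X} → P X → ∃[ C ] Minimal P C × C ⊆ X
  minimal-below {X} = go (⊂-wellFounded X)
    where
    go : ∀ {X} → Acc _⊂_ X → P X → ∃[ C ] Minimal P C × C ⊆ X
    go {X} (acc rec) PX with smaller? X
    ... | no none = X , isMinimal PX none , λ x∈X → x∈X
    ... | yes (D , PD , D⊆X , D≢X) =
      let C , minC , C⊆D = go (rec D⊂X) PD in C , minC , λ x∈C → D⊆X (C⊆D x∈C)
      where
      D⊂X : D ⊂ X
      D⊂X with Fin.any? (λ x → (x ∈? X) ×-dec ¬? (x ∈? D))
      ... | yes w = D⊆X , w
      ... | no none = ⊥-elim (D≢X (⊆-antisym D⊆X λ {x} x∈X →
        decidable-stable (x ∈? D) (λ x∉D → none (x , x∈X , x∉D))))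

∣∪∣+∣∩∣ : ∀ {m} (p q : Subset m) → ∣ p ∪ q ∣ + ∣ p ∩ q ∣ ≡ ∣ p ∣ + ∣ q ∣
∣∪∣+∣∩∣ [] [] = refl
∣∪∣+∣∩∣ (true ∷ p) (true ∷ q) = cong suc (trans (ℕ.+-suc _ _)
  (trans (cong suc (∣∪∣+∣∩∣ p q)) (sym (ℕ.+-suc _ _))))
∣∪∣+∣∩∣ (true ∷ p) (false ∷ q) = cong suc (∣∪∣+∣∩∣ p q)
∣∪∣+∣∩∣ (false ∷ p) (true ∷ q) = trans (cong suc (∣∪∣+∣∩∣ p q)) (sym (ℕ.+-suc _ _))
∣∪∣+∣∩∣ (false ∷ p) (false ∷ q) = ∣∪∣+∣∩∣ p q

∣p∣≤1+∣p-x∣ : ∀ {m} (p : Subset m) x → ∣ p ∣ ≤ suc ∣ p - x ∣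
∣p∣≤1+∣p-x∣ p x = begin
  ∣ p ∣                                        ≤⟨ p⊆q⇒∣p∣≤∣q∣ covers ⟩
  ∣ (p - x) ∪ ⁅ x ⁆ ∣                          ≤⟨ ℕ.m≤m+n _ _ ⟩
  ∣ (p - x) ∪ ⁅ x ⁆ ∣ + ∣ (p - x) ∩ ⁅ x ⁆ ∣    ≡⟨ ∣∪∣+∣∩∣ (p - x) ⁅ x ⁆ ⟩
  ∣ p - x ∣ + ∣ ⁅ x ⁆ ∣                        ≡⟨ cong (∣ p - x ∣ +_) (∣⁅x⁆∣≡1 x) ⟩
  ∣ p - x ∣ + 1                                ≡⟨ ℕ.+-comm _ 1 ⟩
  suc ∣ p - x ∣                                ∎
  where
  open ℕ.≤-Reasoning
  covers : p ⊆ (p - x) ∪ ⁅ x ⁆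
  covers {y} y∈p with y Fin.≟ x
  ... | yes refl = x∈p∪q⁺ (inj₂ (x∈⁅x⁆ x))
  ... | no y≢x = x∈p∪q⁺ (inj₁ (x∈p∧x≢y⇒x∈p-y y∈p y≢x))

∣p∣>0⇒Nonempty : ∀ {m} (p : Subset m) → 0 < ∣ p ∣ → Nonempty p
∣p∣>0⇒Nonempty {m} p 0<∣p∣ with nonempty? p
... | yes ne = ne
... | no empty = ⊥-elim (ℕ.<-irrefl refl
  (subst (0 <_) (trans (cong ∣_∣ (Empty-unique empty)) (∣⊥∣≡0 m)) 0<∣p∣))

------------------------------------------------------------------------
-- Matroids

-- A matroid on Fin m, given by its circuits.  The field circuit? loses no
-- generality classically.

record Matroid (m : ℕ) : Set₁ where
  field
    Circuit     : Pred (Subset m) 0ℓ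
    circuit?    : Decidable Circuit
    nonempty    : ∀ {C} → Circuit C → Nonempty C
    clutter     : ∀ {C D} → Circuit C → Circuit D → C ⊆ D → C ≡ D
    elimination : ∀ {C D e} → Circuit C → Circuit D → C ≢ D → e ∈ C → e ∈ D →
                  ∃[ F ] Circuit F × F ⊆ (C ∪ D) - e

  Independent : Pred (Subset m) 0ℓ
  Independent I = ∀ {C} → Circuit C → ¬ (C ⊆ I)

  Basis : Pred (Subset m) 0ℓ
  Basis B = Independent B × (∀ {I} → Independent I → B ⊆ I → I ≡ B)

  -- The cocircuits are the circuits of the dual matroid, whose bases are the
  -- complements of the bases.

  DualBasis : Pred (Subset m) 0ℓ
  DualBasis B = Basis (∁ B)

  DualDependent : Pred (Subset m) 0ℓ
  DualDependent D = ∀ {B} → DualBasis B → ¬ (D ⊆ B)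

  Cocircuit : Pred (Subset m) 0ℓ
  Cocircuit = Minimal DualDependent

  NonTrivial : Set
  NonTrivial = ∃ Circuit × ∃ Cocircuit

  IsLoop : Pred (Fin m) 0ℓ
  IsLoop e = Circuit ⁅ e ⁆

  IsColoop : Pred (Fin m) 0ℓ
  IsColoop e = ∀ {C} → Circuit C → ¬ (e ∈ C)

  -- E ∖ (L ∪ L*), the domain of ∼.

  Proper : Pred (Fin m) 0ℓ
  Proper e = ¬ (IsLoop e ⊎ IsColoop e)

  infix 4 _∼_

  _∼_ : Fin m → Fin m → Set
  a ∼ b = a ≡ b ⊎ (∃[ C ] Circuit C × a ∈ C × b ∈ C)

  IsEquivalenceClass : Pred (Subset m) 0ℓ
  IsEquivalenceClass X = ∃[ a ] Proper a × (∀ b → b ∈ X ⇔ (Proper b × a ∼ b))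

------------------------------------------------------------------------
-- Graphs

-- Loops and parallel edges are allowed; the order of the pair `ends e` is
-- immaterial.  The vertex set is nonempty, as usual: for the null graph every
-- statement about all components is vacuous, whereas its bicircular matroid
-- has no circuit.

record Graph : Set where
  field
    order : ℕ
    size  : ℕ

  V : Set
  V = Fin order

  E : Set
  E = Fin size

  field
    ends : E → V × V

  Incident : V → E → Set
  Incident v e = v ≡ proj₁ (ends e) ⊎ v ≡ proj₂ (ends e)

  IsIsolated : Pred V 0ℓ
  IsIsolated v = ∀ e → ¬ Incident v e

  field
    {{order≢0}} : NonZero order
    noIsolated  : ∀ v → ¬ IsIsolated v

  incident? : ∀ v e → Dec (Incident v e)
  incident? v e = (v Fin.≟ proj₁ (ends e)) ⊎-dec (v Fin.≟ proj₂ (ends e))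

  IsLink : Pred E 0ℓ
  IsLink e = proj₁ (ends e) ≢ proj₂ (ends e)

  IsLeaf : Pred V 0ℓ
  IsLeaf v = ∃[ e ] Incident v e × (∀ f → Incident v f → f ≡ e) × IsLink e

  Joins : E → V → V → Set
  Joins e u v = ends e ≡ (u , v) ⊎ ends e ≡ (v , u)

module _ (G : Graph) where

  open Graph G

  data Walk : V → V → Set where
    []       : ∀ {v} → Walk v v
    _via_∷_  : ∀ {u v w} (e : E) → Joins e u v → Walk v w → Walk u w

  edges : ∀ {u v} → Walk u v → List E
  edges []            = []
  edges (e via _ ∷ p) = e ∷ edges p

  -- All vertices of a walk, in order, except the first.

  laterVertices : ∀ {u v} → Walk u v → List V
  laterVertices []                        = []
  laterVertices (_via_∷_ {v = v} _ _ p)   = v ∷ laterVertices p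

  record Subgraph : Set where
    field
      verts  : Subset order
      edgs   : Subset size
      closed : ∀ {v e} → e ∈ edgs → Incident v e → v ∈ verts

  open Subgraph

  _≼_ : Subgraph → Subgraph → Set
  H ≼ K = verts H ⊆ verts K × edgs H ⊆ edgs K

  Connected : Pred Subgraph 0ℓ
  Connected H = Nonempty (verts H) ×
    (∀ {u v} → u ∈ verts H → v ∈ verts H →
      Σ (Walk u v) λ p → All (_∈ edgs H) (edges p))

  IsComponent : Pred Subgraph 0ℓ
  IsComponent H = Connected H × (∀ K → Connected K → H ≼ K → K ≼ H)

  -- H consists of the vertices and edges of a closed walk of positive length
  -- without repeated edges or vertices (other than first = last).  Loops and
  -- pairs of parallel edges are cycles of length 1 and 2.

  IsCycle : Pred Subgraph 0ℓ
  IsCycle H = ∃[ v ] Σ (Walk v v) λ p →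
    edges p ≢ [] × Unique (edges p) × Unique (laterVertices p) ×
    (∀ e → e ∈ edgs H ⇔ e List.∈ edges p) ×
    (∀ u → u ∈ verts H ⇔ u List.∈ laterVertices p)

  IsCactiGraph : Set
  IsCactiGraph = (∀ v → ¬ IsIsolated v) × (∀ v → ¬ IsLeaf v) ×
                 (∀ A → IsComponent A → ¬ IsCycle A)

  -- V(G⟨X⟩)

  V⟨_⟩ : Subset size → Subset order
  V⟨ X ⟩ = tabulate λ v → does (Fin.any? λ e → (e ∈? X) ×-dec incident? v e)

  V⟨⟩⁺ : ∀ {X v} → (∃[ e ] e ∈ X × Incident v e) → v ∈ V⟨ X ⟩
  V⟨⟩⁺ {X} {v} w = Vec.lookup⇒[]= v _ (trans (Vec.lookup∘tabulate _ v) eq)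
    where
    eq : does (Fin.any? λ e → (e ∈? X) ×-dec incident? v e) ≡ true
    eq with Fin.any? (λ e → (e ∈? X) ×-dec incident? v e)
    ... | yes _ = refl
    ... | no ¬w = ⊥-elim (¬w w)

  V⟨⟩⁻ : ∀ {X v} → v ∈ V⟨ X ⟩ → ∃[ e ] e ∈ X × Incident v e
  V⟨⟩⁻ {X} {v} v∈ = extract (trans (sym (Vec.lookup∘tabulate _ v)) (Vec.[]=⇒lookup v∈))
    where
    extract : does (Fin.any? λ e → (e ∈? X) ×-dec incident? v e) ≡ true →
              ∃[ e ] e ∈ X × Incident v e
    extract eq with Fin.any? (λ e → (e ∈? X) ×-dec incident? v e)
    extract eq | yes w = w
    extract () | no _

  V⟨⟩-mono : ∀ {X Y} → X ⊆ Y → V⟨ X ⟩ ⊆ V⟨ Y ⟩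
  V⟨⟩-mono X⊆Y v∈ = let e , e∈X , inc = V⟨⟩⁻ v∈ in V⟨⟩⁺ (e , X⊆Y e∈X , inc)

  ∣V⟨⟩∣-mono : ∀ {X Y} → X ⊆ Y → ∣ V⟨ X ⟩ ∣ ≤ ∣ V⟨ Y ⟩ ∣
  ∣V⟨⟩∣-mono X⊆Y = p⊆q⇒∣p∣≤∣q∣ (V⟨⟩-mono X⊆Y)

  ∣V⟨⟩∣-submodular : ∀ X Y →
    ∣ V⟨ X ∪ Y ⟩ ∣ + ∣ V⟨ X ∩ Y ⟩ ∣ ≤ ∣ V⟨ X ⟩ ∣ + ∣ V⟨ Y ⟩ ∣
  ∣V⟨⟩∣-submodular X Y = ℕ.≤-trans
    (ℕ.+-mono-≤ (p⊆q⇒∣p∣≤∣q∣ union) (p⊆q⇒∣p∣≤∣q∣ inter))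
    (ℕ.≤-reflexive (∣∪∣+∣∩∣ V⟨ X ⟩ V⟨ Y ⟩))
    where
    union : V⟨ X ∪ Y ⟩ ⊆ V⟨ X ⟩ ∪ V⟨ Y ⟩
    union v∈ = let e , e∈ , inc = V⟨⟩⁻ v∈ in
      x∈p∪q⁺ (Sum.map (λ e∈X → V⟨⟩⁺ (e , e∈X , inc)) (λ e∈Y → V⟨⟩⁺ (e , e∈Y , inc))
                      (x∈p∪q⁻ X Y e∈))
    inter : V⟨ X ∩ Y ⟩ ⊆ V⟨ X ⟩ ∩ V⟨ Y ⟩
    inter v∈ = x∈p∩q⁺ (V⟨⟩-mono (p∩q⊆p X Y) v∈ , V⟨⟩-mono (p∩q⊆q X Y) v∈)

  IsBicyclic : Pred (Subset size) 0ℓ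
  IsBicyclic C = Nonempty C × ∣ C ∣ ≡ ∣ V⟨ C ⟩ ∣ + 1

  isBicyclic? : Decidable IsBicyclic
  isBicyclic? C = nonempty? C ×-dec (∣ C ∣ ℕ.≟ ∣ V⟨ C ⟩ ∣ + 1)

  -- Deleting an edge lowers ∣X∣ - ∣V⟨X⟩∣ by at most one.

  bicyclic-below : ∀ {X} → ∣ V⟨ X ⟩ ∣ < ∣ X ∣ → ∃[ D ] IsBicyclic D × D ⊆ X
  bicyclic-below {X} = go (⊂-wellFounded X)
    where
    go : ∀ {X} → Acc _⊂_ X → ∣ V⟨ X ⟩ ∣ < ∣ X ∣ → ∃[ D ] IsBicyclic D × D ⊆ X
    go {X} (acc rec) lt with ∣p∣>0⇒Nonempty X (ℕ.≤-trans (s≤s z≤n) lt)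
    ... | e , e∈X with isBicyclic? X
    ... | yes bic = X , bic , λ x∈X → x∈X
    ... | no ¬bic =
      let D , bic , D⊆ = go (rec (x∈p⇒p-x⊂p e∈X)) lt′
      in D , bic , λ x∈D → proj₁ (x∈p⇒p-x⊂p e∈X) (D⊆ x∈D)
      where
      lt″ : suc ∣ V⟨ X ⟩ ∣ < ∣ X ∣
      lt″ = ℕ.≤∧≢⇒< lt λ eq → ¬bic ((e , e∈X) , trans (sym eq) (ℕ.+-comm 1 _))
      lt′ : ∣ V⟨ X - e ⟩ ∣ < ∣ X - e ∣
      lt′ = ℕ.≤-trans (s≤s (∣V⟨⟩∣-mono (proj₁ (x∈p⇒p-x⊂p e∈X))))
                      (s≤s⁻¹ (ℕ.≤-trans lt″ (∣p∣≤1+∣p-x∣ X e)))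

  bicircular-elimination : ∀ {C D e} → Minimal IsBicyclic C → Minimal IsBicyclic D →
    C ≢ D → e ∈ C → e ∈ D → ∃[ F ] Minimal IsBicyclic F × F ⊆ (C ∪ D) - e
  bicircular-elimination {C} {D} {e} ((_ , ∣C∣) , minC) ((_ , ∣D∣) , minD) C≢D e∈C e∈D =
    let F , bicF , F⊆ = bicyclic-below dependent
        F′ , minF′ , F′⊆F = minimal-below isBicyclic? bicF
    in F′ , minF′ , λ x∈F′ → F⊆ (F′⊆F x∈F′)
    where
    open ℕ.≤-Reasoning
    e∈∪ : e ∈ C ∪ D
    e∈∪ = x∈p∪q⁺ (inj₁ e∈C)
    f : Subset size → ℕ
    f X = ∣ V⟨ X ⟩ ∣

    ∩-sparse : ∣ C ∩ D ∣ ≤ f (C ∩ D)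
    ∩-sparse = ℕ.≮⇒≥ λ lt →
      let F , bicF , F⊆ = bicyclic-below lt in
      C≢D (trans (sym (minC bicF λ x∈F → p∩q⊆p C D (F⊆ x∈F)))
                 (minD bicF λ x∈F → p∩q⊆q C D (F⊆ x∈F)))

    ∪-dense : 2 + f (C ∪ D) ≤ ∣ C ∪ D ∣
    ∪-dense = ℕ.+-cancelʳ-≤ (f (C ∩ D)) _ _ (begin
      2 + f (C ∪ D) + f (C ∩ D)    ≤⟨ s≤s (s≤s (∣V⟨⟩∣-submodular C D)) ⟩
      2 + (f C + f D)              ≡⟨ cong suc (ℕ.+-suc (f C) (f D)) ⟨
      suc (f C) + suc (f D)        ≡⟨ cong (_+ suc (f D)) (ℕ.+-comm 1 (f C)) ⟩
      (f C + 1) + suc (f D)        ≡⟨ cong ((f C + 1) +_) (ℕ.+-comm 1 (f D)) ⟩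
      (f C + 1) + (f D + 1)        ≡⟨ cong (_+ (f D + 1)) ∣C∣ ⟨
      ∣ C ∣ + (f D + 1)            ≡⟨ cong (∣ C ∣ +_) ∣D∣ ⟨
      ∣ C ∣ + ∣ D ∣                ≡⟨ ∣∪∣+∣∩∣ C D ⟨
      ∣ C ∪ D ∣ + ∣ C ∩ D ∣        ≤⟨ ℕ.+-monoʳ-≤ ∣ C ∪ D ∣ ∩-sparse ⟩
      ∣ C ∪ D ∣ + f (C ∩ D)        ∎)

    dependent : f ((C ∪ D) - e) < ∣ (C ∪ D) - e ∣
    dependent = ℕ.≤-trans (s≤s (∣V⟨⟩∣-mono (proj₁ (x∈p⇒p-x⊂p e∈∪))))
      (s≤s⁻¹ (ℕ.≤-trans ∪-dense (∣p∣≤1+∣p-x∣ (C ∪ D) e)))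

-- The bicircular matroid.

M₁ : (G : Graph) → Matroid (Graph.size G)
M₁ G = record
  { Circuit     = Minimal (IsBicyclic G)
  ; circuit?    = minimal? (isBicyclic? G)
  ; nonempty    = λ ((ne , _) , _) → ne
  ; clutter     = λ (bicC , _) (_ , minD) C⊆D → minD bicC C⊆D
  ; elimination = bicircular-elimination G
  }

module Submission where

-- Circuits that share a vertex lie in one class of ∼: if they are disjoint,
-- their union has at least three more edges than vertices, so it still contains
-- a circuit after an edge of each is deleted, and ∼ is transitive.  Hence a
-- component all of whose edges lie in circuits is one class.
--
-- In a cacti-graph every edge e lies in a circuit.  Otherwise e is in every
-- basis B.  Let T be the largest subset of B - e with |T| = |V(T)|, and let
-- Z = B ─ T and W = V ∖ V(T).  All edges at W belong to Z, and |Z| ≤ |W|.  As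
-- every vertex of W has degree at least two, counting ends shows that all edges
-- of Z have both ends in W.  So W contains a cycle, and counting again after
-- its removal shows that it is a component.
--
-- Conversely, deleting an edge from a circuit does not change its vertex set,
-- so an edge at a leaf is in no circuit; and a cycle component contains no
-- circuit, having no subset with more edges than vertices.

open import Defs
open import Data.Empty using (⊥-elim)
open import Data.Fin using (Fin; fromℕ<)
import Data.Fin.Properties as Fin
open import Data.Fin.Subset
  using (Subset; ⊥; ⊤; _∈_; _∉_; _⊆_; _⊂_; _⊃_; _∪_; _∩_; _─_; _-_; ∁; ∣_∣; ⁅_⁆; Nonempty)
open import Data.Fin.Subset.Induction using (⊂-wellFounded; ⊃-wellFounded)
open import Data.Fin.Subset.Properties
open import Data.List using (List; []; _∷_; length)
import Data.List.Membership.Propositional as List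
import Data.List.Membership.DecPropositional as DecList
open import Data.List.Relation.Unary.All as All using (All; []; _∷_)
open import Data.List.Relation.Unary.All.Properties using (anti-mono; ¬Any⇒All¬; All¬⇒¬Any)
open import Data.List.Relation.Unary.AllPairs using ([]; _∷_)
open import Data.List.Relation.Unary.Any using (here; there)
open import Data.List.Relation.Unary.Unique.Propositional using (Unique)
open import Data.Nat using (ℕ; suc; _+_; _≤_; _<_; z≤n; s≤s; s≤s⁻¹; >-nonZero⁻¹)
import Data.Nat.Properties as ℕ
open import Data.Product using (Σ; ∃; ∃-syntax; _×_; _,_; proj₁; proj₂)
open import Data.Sum using (_⊎_; inj₁; inj₂; [_,_]′)
import Data.Sum as Sum
open import Data.Vec using (_∷_; here; there; lookup; tabulate)
import Data.Vec.Properties as Vec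
open import Function using (_⇔_; mk⇔; Equivalence; _∘_)
open import Induction.WellFounded using (Acc; acc)
open import Level using (0ℓ)
open import Relation.Binary.PropositionalEquality
  using (_≡_; _≢_; refl; sym; trans; cong; subst)
open import Relation.Nullary using (¬_; Dec; yes; no; _×-dec_; ¬?)
open import Relation.Nullary.Decidable using (map′; decidable-stable)
open import Relation.Unary using (Pred; Decidable)

-- Finite sets

x∈q⇒x∉p─q : ∀ {m} (p q : Subset m) {x} → x ∈ q → x ∉ p ─ q
x∈q⇒x∉p─q (_ ∷ p) (_ ∷ q) here ()
x∈q⇒x∉p─q (_ ∷ p) (_ ∷ q) (there x∈q) (there x∈) = x∈q⇒x∉p─q p q x∈q x∈

x∉p-x : ∀ {m} (p : Subset m) {x} → x ∉ p - x
x∉p-x p {x} = x∈q⇒x∉p─q p ⁅ x ⁆ (x∈⁅x⁆ x)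

module _ {m} {p q r : Subset m} where

  ∣p∣≤∣q∣+∣r∣ : (∀ {x} → x ∈ p → x ∈ q ⊎ x ∈ r) → ∣ p ∣ ≤ ∣ q ∣ + ∣ r ∣
  ∣p∣≤∣q∣+∣r∣ covered = begin
    ∣ p ∣                    ≤⟨ p⊆q⇒∣p∣≤∣q∣ (λ x∈p → x∈p∪q⁺ (covered x∈p)) ⟩
    ∣ q ∪ r ∣                ≤⟨ ℕ.m≤m+n _ _ ⟩
    ∣ q ∪ r ∣ + ∣ q ∩ r ∣    ≡⟨ ∣∪∣+∣∩∣ q r ⟩
    ∣ q ∣ + ∣ r ∣            ∎
    where open ℕ.≤-Reasoning

  ∣p∣+∣q∣≤∣r∣ : p ⊆ r → q ⊆ r → (∀ {x} → x ∈ p → x ∉ q) → ∣ p ∣ + ∣ q ∣ ≤ ∣ r ∣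
  ∣p∣+∣q∣≤∣r∣ p⊆r q⊆r disjoint = begin
    ∣ p ∣ + ∣ q ∣            ≡⟨ ∣∪∣+∣∩∣ p q ⟨
    ∣ p ∪ q ∣ + ∣ p ∩ q ∣    ≡⟨ cong (λ s → ∣ p ∪ q ∣ + ∣ s ∣) (Empty-unique empty) ⟩
    ∣ p ∪ q ∣ + ∣ ⊥ {m} ∣    ≡⟨ cong (∣ p ∪ q ∣ +_) (∣⊥∣≡0 m) ⟩
    ∣ p ∪ q ∣ + 0            ≡⟨ ℕ.+-identityʳ _ ⟩
    ∣ p ∪ q ∣                ≤⟨ p⊆q⇒∣p∣≤∣q∣ (λ x∈ → [ p⊆r , q⊆r ]′ (x∈p∪q⁻ p q x∈)) ⟩
    ∣ r ∣                    ∎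
    where
    open ℕ.≤-Reasoning
    empty : ¬ Nonempty (p ∩ q)
    empty (x , x∈) = let x∈p , x∈q = x∈p∩q⁻ p q x∈ in disjoint x∈p x∈q

module _ {m} {p q : Subset m} where

  ∣p∣≤∣p─q∣+∣q∣ : ∣ p ∣ ≤ ∣ p ─ q ∣ + ∣ q ∣
  ∣p∣≤∣p─q∣+∣q∣ = ∣p∣≤∣q∣+∣r∣ λ {x} x∈p → split x∈p (x ∈? q)
    where
    split : ∀ {x} → x ∈ p → Dec (x ∈ q) → x ∈ p ─ q ⊎ x ∈ q
    split x∈p (yes x∈q) = inj₂ x∈q
    split x∈p (no x∉q)  = inj₁ (x∈p∧x∉q⇒x∈p─q x∈p x∉q)

  ∣p─q∣+∣q∣≤∣p∣ : q ⊆ p → ∣ p ─ q ∣ + ∣ q ∣ ≤ ∣ p ∣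
  ∣p─q∣+∣q∣≤∣p∣ q⊆p = ∣p∣+∣q∣≤∣r∣ (p─q⊆p p q) q⊆p λ x∈ x∈q → x∈q⇒x∉p─q p q x∈q x∈

  ⊆∧∣q∣≤∣p∣⇒⊇ : p ⊆ q → ∣ q ∣ ≤ ∣ p ∣ → q ⊆ p
  ⊆∧∣q∣≤∣p∣⇒⊇ p⊆q ∣q∣≤∣p∣ {x} x∈q = decidable-stable (x ∈? p) λ x∉p →
    ℕ.<⇒≱ (p⊂q⇒∣p∣<∣q∣ (p⊆q , x , x∈q , x∉p)) ∣q∣≤∣p∣

  ⊈-witness : ¬ p ⊆ q → ∃[ x ] x ∈ p × x ∉ q
  ⊈-witness p⊈q with Fin.any? (λ x → (x ∈? p) ×-dec ¬? (x ∈? q))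
  ... | yes w   = w
  ... | no none = ⊥-elim (p⊈q λ {x} x∈p →
    decidable-stable (x ∈? q) λ x∉q → none (x , x∈p , x∉q))

⁅x⁆⊆p : ∀ {m} {p : Subset m} {x} → x ∈ p → ⁅ x ⁆ ⊆ p
⁅x⁆⊆p {p = p} x∈p y∈ = subst (_∈ p) (sym (x∈⁅y⁆⇒x≡y _ y∈)) x∈p

x∈p⇒1≤∣p∣ : ∀ {m} {p : Subset m} {x} → x ∈ p → 1 ≤ ∣ p ∣
x∈p⇒1≤∣p∣ {p = p} {x} x∈p = subst (_≤ ∣ p ∣) (∣⁅x⁆∣≡1 x) (p⊆q⇒∣p∣≤∣q∣ (⁅x⁆⊆p x∈p))

x≢y⇒2≤∣p∣ : ∀ {m} {p : Subset m} {x y} → x ∈ p → y ∈ p → x ≢ y → 2 ≤ ∣ p ∣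
x≢y⇒2≤∣p∣ {p = p} {x} {y} x∈p y∈p x≢y = ℕ.≤-trans
  (ℕ.+-mono-≤ (x∈p⇒1≤∣p∣ (x∈⁅x⁆ x)) (x∈p⇒1≤∣p∣ (x∈⁅x⁆ y)))
  (∣p∣+∣q∣≤∣r∣ (⁅x⁆⊆p x∈p) (⁅x⁆⊆p y∈p) λ z∈ z∈′ →
    x≢y (trans (sym (x∈⁅y⁆⇒x≡y x z∈)) (x∈⁅y⁆⇒x≡y y z∈′)))

maximal-exists : ∀ {m} {P : Pred (Subset m) 0ℓ} → Decidable P → ∀ {X} → P X →
  ∃[ Y ] P Y × (∀ {Z} → P Z → Y ⊆ Z → Z ≡ Y)
maximal-exists {P = P} P? {X} = go (⊃-wellFounded X)
  where
  go : ∀ {X} → Acc _⊃_ X → P X → ∃[ Y ] P Y × (∀ {Z} → P Z → Y ⊆ Z → Z ≡ Y)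
  go {X} (acc rec) PX with anySubset? (λ Y → P? Y ×-dec (X ⊂? Y))
  ... | yes (Y , PY , X⊂Y) = go (rec X⊂Y) PY
  ... | no none = X , PX , λ {Z} PZ X⊆Z → ⊆-antisym
    (λ {x} x∈Z → decidable-stable (x ∈? X) λ x∉X → none (Z , PZ , X⊆Z , x , x∈Z , x∉X))
    X⊆Z

fromList : ∀ {m} → List (Fin m) → Subset m
fromList []       = ⊥
fromList (x ∷ xs) = ⁅ x ⁆ ∪ fromList xs

∈-fromList⁺ : ∀ {m} {xs : List (Fin m)} {x} → x List.∈ xs → x ∈ fromList xs
∈-fromList⁺ (here refl) = x∈p∪q⁺ (inj₁ (x∈⁅x⁆ _))
∈-fromList⁺ (there x∈)  = x∈p∪q⁺ (inj₂ (∈-fromList⁺ x∈))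

∈-fromList⁻ : ∀ {m} (xs : List (Fin m)) {x} → x ∈ fromList xs → x List.∈ xs
∈-fromList⁻ []       x∈ = ⊥-elim (∉⊥ x∈)
∈-fromList⁻ (y ∷ xs) x∈ with x∈p∪q⁻ ⁅ y ⁆ (fromList xs) x∈
... | inj₁ x∈⁅y⁆ = here (x∈⁅y⁆⇒x≡y y x∈⁅y⁆)
... | inj₂ x∈xs  = there (∈-fromList⁻ xs x∈xs)

∣fromList∣≤length : ∀ {m} (xs : List (Fin m)) → ∣ fromList xs ∣ ≤ length xs
∣fromList∣≤length {m} []   = ℕ.≤-reflexive (∣⊥∣≡0 m)
∣fromList∣≤length (x ∷ xs) = ℕ.≤-trans
  (∣p∣≤∣q∣+∣r∣ {q = ⁅ x ⁆} {fromList xs} (x∈p∪q⁻ _ _))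
  (ℕ.+-mono-≤ (ℕ.≤-reflexive (∣⁅x⁆∣≡1 x)) (∣fromList∣≤length xs))

length≤∣fromList∣ : ∀ {m} {xs : List (Fin m)} → Unique xs → length xs ≤ ∣ fromList xs ∣
length≤∣fromList∣ [] = z≤n
length≤∣fromList∣ {xs = x ∷ xs} (x∉xs ∷ unique) = ℕ.≤-trans
  (ℕ.+-mono-≤ (ℕ.≤-reflexive (sym (∣⁅x⁆∣≡1 x))) (length≤∣fromList∣ unique))
  (∣p∣+∣q∣≤∣r∣ (p⊆p∪q _) (q⊆p∪q ⁅ x ⁆ _) λ y∈ y∈′ →
    All¬⇒¬Any x∉xs (∈-fromList⁻ xs (subst (_∈ fromList xs) (x∈⁅y⁆⇒x≡y x y∈) y∈′)))

preimage : ∀ {m n} → (Fin m → Fin n) → Subset n → Subset m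
preimage f Y = tabulate (lookup Y ∘ f)

module _ {m n} (f : Fin m → Fin n) (Y : Subset n) {x : Fin m} where

  ∈-preimage⁺ : f x ∈ Y → x ∈ preimage f Y
  ∈-preimage⁺ fx∈ = Vec.lookup⇒[]= x _
    (trans (Vec.lookup∘tabulate (lookup Y ∘ f) x) (Vec.[]=⇒lookup fx∈))

  ∈-preimage⁻ : x ∈ preimage f Y → f x ∈ Y
  ∈-preimage⁻ x∈ = Vec.lookup⇒[]= (f x) Y
    (trans (sym (Vec.lookup∘tabulate (lookup Y ∘ f) x)) (Vec.[]=⇒lookup x∈))

-- Matroids

module _ {m} (M : Matroid m) where

  open Matroid M

  circuit-below? : ∀ X → Dec (∃[ C ] Circuit C × C ⊆ X)
  circuit-below? X = anySubset? λ C → circuit? C ×-dec (C ⊆? X)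

  independent? : Decidable Independent
  independent? X = map′ {A = ¬ (∃[ C ] Circuit C × C ⊆ X)}
    (λ none circC C⊆X → none (_ , circC , C⊆X))
    (λ ind (_ , circC , C⊆X) → ind circC C⊆X)
    (¬? (circuit-below? X))

  ¬independent⇒circuit : ∀ {X} → ¬ Independent X → ∃[ C ] Circuit C × C ⊆ X
  ¬independent⇒circuit {X} ¬ind = decidable-stable (circuit-below? X) λ none →
    ¬ind λ circC C⊆X → none (_ , circC , C⊆X)

  independent-⊆ : ∀ {I J} → I ⊆ J → Independent J → Independent I
  independent-⊆ I⊆J indJ circC C⊆I = indJ circC λ x∈C → I⊆J (C⊆I x∈C)

  ⊥-independent : Independent ⊥
  ⊥-independent circC C⊆⊥ = let _ , x∈C = nonempty circC in ∉⊥ (C⊆⊥ x∈C)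

  basis? : Decidable Basis
  basis? B = map′ {A = Independent B × ¬ (∃[ I ] Independent I × B ⊆ I × I ≢ B)}
    (λ (ind , none) → ind , λ {I} indI B⊆I → decidable-stable (I ≟ˢ B) λ I≢B →
      none (I , indI , B⊆I , I≢B))
    (λ (ind , max) → ind , λ (I , indI , B⊆I , I≢B) → I≢B (max indI B⊆I))
    (independent? B ×-dec ¬? (anySubset? λ I →
      independent? I ×-dec (B ⊆? I) ×-dec ¬? (I ≟ˢ B)))

  basis-exists : ∃ Basis
  basis-exists = maximal-exists independent? ⊥-independent

  -- By maximality `B ∪ ⁅ e ⁆` contains a circuit, and this circuit must use `e` because `B` is
  -- independent. It is the fundamental circuit of `e`.
  basis-∌⇒circuit : ∀ {B e} → Basis B → e ∉ B → ∃[ C ] Circuit C × e ∈ C × C ⊆ B ∪ ⁅ e ⁆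
  basis-∌⇒circuit {B} {e} (ind , max) e∉B =
    C , circC , decidable-stable (e ∈? C) e∈C , C⊆
    where
    dependent : ¬ Independent (B ∪ ⁅ e ⁆)
    dependent ind′ = e∉B (subst (e ∈_) (max ind′ (p⊆p∪q _)) (q⊆p∪q B _ (x∈⁅x⁆ e)))
    w = ¬independent⇒circuit dependent
    C = proj₁ w
    circC = proj₁ (proj₂ w)
    C⊆ : C ⊆ B ∪ ⁅ e ⁆
    C⊆ = proj₂ (proj₂ w)
    e∈C : ¬ ¬ (e ∈ C)
    e∈C e∉C = ind circC λ {x} x∈C → [ (λ x∈B → x∈B) ,
      (λ x∈⁅e⁆ → ⊥-elim (e∉C (subst (_∈ C) (x∈⁅y⁆⇒x≡y e x∈⁅e⁆) x∈C))) ]′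
      (x∈p∪q⁻ B ⁅ e ⁆ (C⊆ x∈C))

  dualDependent? : Decidable DualDependent
  dualDependent? D = map′ {A = ¬ (∃[ B ] DualBasis B × D ⊆ B)}
    (λ none {B} basis D⊆B → none (B , basis , D⊆B))
    (λ dep (B , basis , D⊆B) → dep basis D⊆B)
    (¬? (anySubset? λ B → basis? (∁ B) ×-dec (D ⊆? B)))

  -- The whole ground set is dependent in the dual: otherwise the empty set would be a basis, and
  -- the independent set `⁅ e ⁆` would extend it. A minimal dual dependent set is a cocircuit.
  cocircuit-exists : ∀ {e} → Independent ⁅ e ⁆ → ∃ Cocircuit
  cocircuit-exists {e} ind =
    let C , cocircuit , _ = minimal-below dualDependent? dependent in C , cocircuit
    where
    dependent : DualDependent ⊤
    dependent {B} (_ , max) ⊤⊆B = x∈∁p⇒x∉p (subst (e ∈_) ⁅e⁆≡∁B (x∈⁅x⁆ e)) (⊤⊆B ∈⊤)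
      where
      ⁅e⁆≡∁B : ⁅ e ⁆ ≡ ∁ B
      ⁅e⁆≡∁B = max ind λ x∈∁B → ⊥-elim (x∈∁p⇒x∉p x∈∁B (⊤⊆B ∈⊤))

  -- Strong circuit elimination and transitivity of ∼

  circuit-⊈ : ∀ {C D x} → Circuit C → Circuit D → x ∈ D → x ∉ C → ∃[ y ] y ∈ C × y ∉ D
  circuit-⊈ {x = x} circC circD x∈D x∉C = ⊈-witness λ C⊆D →
    x∉C (subst (x ∈_) (sym (clutter circC circD C⊆D)) x∈D)

  -- Induction on `C ∪ D`. Weak elimination gives `F` without `e`. If `F` misses `f`, take `x` in
  -- `F` outside `C`, so that `x ∈ D`. Eliminating `x` from `D` and `F` while keeping `e` gives `H`;
  -- eliminating `e` from `C` and `H` while keeping `f` gives the answer. The first union misses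
  -- `f`, the second misses `x`, so both are smaller.
  strong-elimination : ∀ {C D e f} → Circuit C → Circuit D →
    e ∈ C → e ∈ D → f ∈ C → f ∉ D →
    ∃[ F ] Circuit F × f ∈ F × (∀ {x} → x ∈ F → x ∈ C ⊎ x ∈ D) × e ∉ F
  strong-elimination {C} {D} = go (⊂-wellFounded (C ∪ D))
    where
    go : ∀ {C D e f} → Acc _⊂_ (C ∪ D) → Circuit C → Circuit D →
      e ∈ C → e ∈ D → f ∈ C → f ∉ D →
      ∃[ F ] Circuit F × f ∈ F × (∀ {x} → x ∈ F → x ∈ C ⊎ x ∈ D) × e ∉ F
    go {C} {D} {e} {f} (acc rec) circC circD e∈C e∈D f∈C f∉D
      with elimination circC circD (λ { refl → f∉D f∈C }) e∈C e∈D
    ... | F , circF , F⊆ = answer (f ∈? F)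
      where
      F⊆C∪D : ∀ {x} → x ∈ F → x ∈ C ⊎ x ∈ D
      F⊆C∪D x∈F = x∈p∪q⁻ C D (p─q⊆p (C ∪ D) ⁅ e ⁆ (F⊆ x∈F))
      e∉F : e ∉ F
      e∉F e∈F = x∉p-x (C ∪ D) (F⊆ e∈F)
      answer : Dec (f ∈ F) →
        ∃[ F ] Circuit F × f ∈ F × (∀ {x} → x ∈ F → x ∈ C ⊎ x ∈ D) × e ∉ F
      answer (yes f∈F) = F , circF , f∈F , F⊆C∪D , e∉F
      answer (no f∉F) =
        let x , x∈F , x∉C = circuit-⊈ circF circC e∈C e∉F
            x∈D = [ (λ x∈C → ⊥-elim (x∉C x∈C)) , (λ x∈D → x∈D) ]′ (F⊆C∪D x∈F)
            H , circH , e∈H , H⊆ , x∉H =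
              go (rec (D∪F⊂ , f , x∈p∪q⁺ (inj₁ f∈C) , λ f∈ → [ f∉D , f∉F ]′ (x∈p∪q⁻ D F f∈)))
                 circD circF x∈D x∈F e∈D e∉F
            f∉H = λ f∈H → [ f∉D , f∉F ]′ (H⊆ f∈H)
            H⊆C∪D : ∀ {y} → y ∈ H → y ∈ C ⊎ y ∈ D
            H⊆C∪D y∈H = [ inj₂ , F⊆C∪D ]′ (H⊆ y∈H)
            K , circK , f∈K , K⊆ , e∉K =
              go (rec ((λ y∈ → x∈p∪q⁺ ([ inj₁ , H⊆C∪D ]′ (x∈p∪q⁻ C H y∈))) ,
                       x , x∈p∪q⁺ (inj₂ x∈D) , λ x∈ → [ x∉C , x∉H ]′ (x∈p∪q⁻ C H x∈)))
                 circC circH e∈C e∈H f∈C f∉H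
        in K , circK , f∈K , (λ y∈K → [ inj₁ , H⊆C∪D ]′ (K⊆ y∈K)) , e∉K
        where
        D∪F⊂ : D ∪ F ⊆ C ∪ D
        D∪F⊂ y∈ = x∈p∪q⁺ ([ inj₂ , F⊆C∪D ]′ (x∈p∪q⁻ D F y∈))

  -- This is the transitivity of `∼`, by induction on `C ∪ D`. Strong elimination of `e` gives `C′`
  -- through `a` and `D′` through `b`. Each leaves the circuit it came from, at `g ∈ D` and `h ∈ C`
  -- respectively. The pair `C′`, `D′` or the pair `C′`, `D` meets again, in `h` or in `g`, and its
  -- union lacks `e` or `h`.
  common-circuit : ∀ {C D e a b} → Circuit C → Circuit D →
    e ∈ C → e ∈ D → a ∈ C → b ∈ D → ∃[ F ] Circuit F × a ∈ F × b ∈ F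
  common-circuit {C} {D} {a = a} {b} = go (⊂-wellFounded (C ∪ D))
    where
    go : ∀ {C D e} → Acc _⊂_ (C ∪ D) → Circuit C → Circuit D →
      e ∈ C → e ∈ D → a ∈ C → b ∈ D → ∃[ F ] Circuit F × a ∈ F × b ∈ F
    go {C} {D} {e} (acc rec) circC circD e∈C e∈D a∈C b∈D with b ∈? C | a ∈? D
    ... | yes b∈C | _       = C , circC , a∈C , b∈C
    ... | no _    | yes a∈D = D , circD , a∈D , b∈D
    ... | no b∉C  | no a∉D
      with strong-elimination circC circD e∈C e∈D a∈C a∉D
         | strong-elimination circD circC e∈D e∈C b∈D b∉C
    ... | C′ , circC′ , a∈C′ , C′⊆ , e∉C′ | D′ , circD′ , b∈D′ , D′⊆ , e∉D′
      with circuit-⊈ circC′ circC e∈C e∉C′ | circuit-⊈ circD′ circD e∈D e∉D′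
    ... | g , g∈C′ , g∉C | h , h∈D′ , h∉D with h ∈? C′
    ... | yes h∈C′ = go (rec (below , e , x∈p∪q⁺ (inj₁ e∈C) , e∉))
            circC′ circD′ h∈C′ h∈D′ a∈C′ b∈D′
      where
      below : C′ ∪ D′ ⊆ C ∪ D
      below x∈ = x∈p∪q⁺ ([ C′⊆ , (λ x∈D′ → Sum.swap (D′⊆ x∈D′)) ]′ (x∈p∪q⁻ C′ D′ x∈))
      e∉ : e ∉ C′ ∪ D′
      e∉ e∈ = [ e∉C′ , e∉D′ ]′ (x∈p∪q⁻ C′ D′ e∈)
    ... | no h∉C′ = go (rec (below , h , x∈p∪q⁺ (Sum.swap (D′⊆ h∈D′)) , h∉))
            circC′ circD g∈C′ g∈D a∈C′ b∈D
      where
      below : C′ ∪ D ⊆ C ∪ D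
      below x∈ = x∈p∪q⁺ ([ C′⊆ , inj₂ ]′ (x∈p∪q⁻ C′ D x∈))
      h∉ : h ∉ C′ ∪ D
      h∉ h∈ = [ h∉C′ , h∉D ]′ (x∈p∪q⁻ C′ D h∈)
      g∈D : g ∈ D
      g∈D = [ (λ g∈C → ⊥-elim (g∉C g∈C)) , (λ g∈D → g∈D) ]′ (C′⊆ g∈C′)

  -- Since `F` is contained in neither `C` nor `D`, it meets both. So `F` links `a` to `b`, by
  -- transitivity through `h` in `C` and `g` in `D`.
  crossing⇒common-circuit : ∀ {C D F a b} → Circuit C → Circuit D → Circuit F →
    (∀ {x} → x ∈ F → x ∈ C ⊎ x ∈ D) → a ∈ C → a ∉ F → b ∈ D → b ∉ F →
    ∃[ H ] Circuit H × a ∈ H × b ∈ H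
  crossing⇒common-circuit circC circD circF F⊆ a∈C a∉F b∈D b∉F
    with circuit-⊈ circF circC a∈C a∉F | circuit-⊈ circF circD b∈D b∉F
  ... | g , g∈F , g∉C | h , h∈F , h∉D
    with common-circuit circC circF
           ([ (λ h∈C → h∈C) , (λ h∈D → ⊥-elim (h∉D h∈D)) ]′ (F⊆ h∈F)) h∈F a∈C g∈F
  ... | H , circH , a∈H , g∈H = common-circuit circH circD
    g∈H ([ (λ g∈C → ⊥-elim (g∉C g∈C)) , (λ g∈D → g∈D) ]′ (F⊆ g∈F)) a∈H b∈D

module _ (G : Graph) where

  open Graph G renaming (V to Vertex; E to Edge)
  open Matroid (M₁ G)

  -- Density of edge sets

  private
    ν : Subset size → ℕ
    ν X = ∣ V⟨ G ⟩ X ∣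

    V : Subset size → Subset order
    V = V⟨ G ⟩

  -- For the vertices and edges of a connected subgraph, this is the condition that it is a
  -- component.
  Saturated : Subset order → Subset size → Set
  Saturated W Z = ∀ {w e} → w ∈ W → Incident w e → e ∈ Z

  dense⇒circuit : ∀ {X} → ν X < ∣ X ∣ → ∃[ C ] Circuit C × C ⊆ X
  dense⇒circuit lt =
    let D , bicD , D⊆X = bicyclic-below G lt
        C , circC , C⊆D = minimal-below (isBicyclic? G) bicD
    in C , circC , λ x∈C → D⊆X (C⊆D x∈C)

  independent⇒sparse : ∀ {I} → Independent I → ∣ I ∣ ≤ ν I
  independent⇒sparse ind = ℕ.≮⇒≥ λ lt →
    let _ , circC , C⊆I = dense⇒circuit lt in ind circC C⊆I

  ∣circuit∣ : ∀ {C} → Circuit C → ∣ C ∣ ≡ suc (ν C)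
  ∣circuit∣ ((_ , eq) , _) = trans eq (ℕ.+-comm _ 1)

  ⊂circuit⇒independent : ∀ {C I x} → Circuit C → I ⊆ C → x ∈ C → x ∉ I → Independent I
  ⊂circuit⇒independent circC I⊆C x∈C x∉I circD D⊆I = x∉I (D⊆I (subst (_ ∈_)
    (sym (clutter circD circC λ x∈D → I⊆C (D⊆I x∈D))) x∈C))

  circuit-minus-tight : ∀ {C} x → Circuit C → ν C ≤ ∣ C - x ∣
  circuit-minus-tight {C} x circC =
    s≤s⁻¹ (subst (_≤ suc ∣ C - x ∣) (∣circuit∣ circC) (∣p∣≤1+∣p-x∣ C x))

  -- `C - x` has at least `ν C` edges and, being independent, at most `ν (C - x)`; so no vertex is
  -- lost.
  V-circuit-minus : ∀ {C x} → Circuit C → x ∈ C → V C ⊆ V (C - x)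
  V-circuit-minus {C} {x} circC x∈C = ⊆∧∣q∣≤∣p∣⇒⊇ (V⟨⟩-mono G (p─q⊆p C ⁅ x ⁆))
    (ℕ.≤-trans (circuit-minus-tight x circC)
      (independent⇒sparse (⊂circuit⇒independent circC (p─q⊆p C ⁅ x ⁆) x∈C (x∉p-x C))))

  -- A circuit spans at least one vertex and so has at least two edges. Hence the matroid has no
  -- loops, even at loops of the graph.
  ⁅e⁆-independent : ∀ e → Independent ⁅ e ⁆
  ⁅e⁆-independent e {C} circC C⊆⁅e⁆ = ℕ.<⇒≱ (begin-strict
    ∣ C ∣          ≤⟨ p⊆q⇒∣p∣≤∣q∣ C⊆⁅e⁆ ⟩
    ∣ ⁅ e ⁆ ∣      ≡⟨ ∣⁅x⁆∣≡1 e ⟩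
    1              <⟨ s≤s (x∈p⇒1≤∣p∣ (V⟨⟩⁺ G (x , x∈C , inj₁ refl))) ⟩
    suc (ν C)      ≡⟨ ∣circuit∣ circC ⟨
    ∣ C ∣          ∎) ℕ.≤-refl
    where
    open ℕ.≤-Reasoning
    x = proj₁ (nonempty circC)
    x∈C = proj₂ (nonempty circC)

  ∈circuit⇒Proper : ∀ {C e} → Circuit C → e ∈ C → Proper e
  ∈circuit⇒Proper {e = e} circC e∈C =
    [ (λ loop → ⁅e⁆-independent e loop λ x∈ → x∈) , (λ coloop → coloop circC e∈C) ]′

  V-∪ : ∀ X Y {v} → v ∈ V (X ∪ Y) → v ∈ V X ⊎ v ∈ V Y
  V-∪ X Y v∈ with V⟨⟩⁻ G v∈
  ... | e , e∈ , inc = Sum.map (λ e∈X → V⟨⟩⁺ G (e , e∈X , inc))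
                               (λ e∈Y → V⟨⟩⁺ G (e , e∈Y , inc)) (x∈p∪q⁻ X Y e∈)

  -- Submodularity of `ν`, with `S ∩ T` sparse because it lies in the independent set `T`.
  tight-∪ : ∀ {S T} → Independent T → ν S ≤ ∣ S ∣ → ν T ≤ ∣ T ∣ → ν (S ∪ T) ≤ ∣ S ∪ T ∣
  tight-∪ {S} {T} ind tightS tightT = ℕ.+-cancelʳ-≤ (ν (S ∩ T)) _ _ (begin
    ν (S ∪ T) + ν (S ∩ T)      ≤⟨ ∣V⟨⟩∣-submodular G S T ⟩
    ν S + ν T                  ≤⟨ ℕ.+-mono-≤ tightS tightT ⟩
    ∣ S ∣ + ∣ T ∣              ≡⟨ ∣∪∣+∣∩∣ S T ⟨
    ∣ S ∪ T ∣ + ∣ S ∩ T ∣      ≤⟨ ℕ.+-monoʳ-≤ _ (independent⇒sparse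
                                    (independent-⊆ (M₁ G) (p∩q⊆q S T) ind)) ⟩
    ∣ S ∪ T ∣ + ν (S ∩ T)      ∎)
    where open ℕ.≤-Reasoning

  -- Each circuit has one more edge than vertices, and the shared vertex `v` is counted twice. So
  -- `C ∪ D` has an excess of at least three edges, of which one survives the deletion of `a` and
  -- `b`.
  disjoint⇒circuit-avoiding : ∀ {C D v} a b → Circuit C → Circuit D →
    v ∈ V C → v ∈ V D → ¬ Nonempty (C ∩ D) →
    ∃[ F ] Circuit F × (∀ {x} → x ∈ F → x ∈ C ⊎ x ∈ D) × a ∉ F × b ∉ F
  disjoint⇒circuit-avoiding {C} {D} {v} a b circC circD v∈C v∈D disjoint =
    let F , circF , F⊆X = dense⇒circuit dense in F , circF ,
      (λ x∈F → x∈p∪q⁻ C D (X⊆ (F⊆X x∈F))) ,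
      (λ a∈F → x∉p-x (C ∪ D) (p─q⊆p ((C ∪ D) - a) ⁅ b ⁆ (F⊆X a∈F))) ,
      (λ b∈F → x∉p-x ((C ∪ D) - a) (F⊆X b∈F))
    where
    open ℕ.≤-Reasoning
    X = (C ∪ D) - a - b
    X⊆ : X ⊆ C ∪ D
    X⊆ x∈ = p─q⊆p (C ∪ D) ⁅ a ⁆ (p─q⊆p ((C ∪ D) - a) ⁅ b ⁆ x∈)
    ν-bound : suc (ν X) ≤ ν C + ν D
    ν-bound = begin
      suc (ν X)                         ≡⟨ ℕ.+-comm 1 (ν X) ⟩
      ν X + 1                           ≤⟨ ℕ.+-mono-≤
        (p⊆q⇒∣p∣≤∣q∣ λ x∈ → x∈p∪q⁺ (V-∪ C D (V⟨⟩-mono G X⊆ x∈)))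
        (x∈p⇒1≤∣p∣ (x∈p∩q⁺ (v∈C , v∈D))) ⟩
      ∣ V C ∪ V D ∣ + ∣ V C ∩ V D ∣     ≡⟨ ∣∪∣+∣∩∣ (V C) (V D) ⟩
      ν C + ν D                         ∎
    dense : ν X < ∣ X ∣
    dense = s≤s⁻¹ (s≤s⁻¹ (begin
      3 + ν X                ≤⟨ s≤s (s≤s ν-bound) ⟩
      2 + (ν C + ν D)        ≡⟨ cong suc (ℕ.+-suc (ν C) (ν D)) ⟨
      suc (ν C) + suc (ν D)  ≡⟨ cong (_+ suc (ν D)) (∣circuit∣ circC) ⟨
      ∣ C ∣ + suc (ν D)      ≡⟨ cong (∣ C ∣ +_) (∣circuit∣ circD) ⟨
      ∣ C ∣ + ∣ D ∣          ≤⟨ ∣p∣+∣q∣≤∣r∣ (p⊆p∪q D) (q⊆p∪q C D)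
                                 (λ x∈C x∈D → disjoint (_ , x∈p∩q⁺ (x∈C , x∈D))) ⟩
      ∣ C ∪ D ∣              ≤⟨ ∣p∣≤1+∣p-x∣ (C ∪ D) a ⟩
      suc ∣ (C ∪ D) - a ∣    ≤⟨ s≤s (∣p∣≤1+∣p-x∣ ((C ∪ D) - a) b) ⟩
      2 + ∣ X ∣              ∎))

  common-vertex⇒common-circuit : ∀ {C D v a b} → Circuit C → Circuit D →
    v ∈ V C → v ∈ V D → a ∈ C → b ∈ D → ∃[ F ] Circuit F × a ∈ F × b ∈ F
  common-vertex⇒common-circuit {C} {D} {v} {a} {b} circC circD v∈C v∈D a∈C b∈D =
    by-cases (nonempty? (C ∩ D))
    where
    by-cases : Dec (Nonempty (C ∩ D)) → ∃[ F ] Circuit F × a ∈ F × b ∈ F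
    by-cases (yes (e , e∈)) = let e∈C , e∈D = x∈p∩q⁻ C D e∈ in
      common-circuit (M₁ G) circC circD e∈C e∈D a∈C b∈D
    by-cases (no disjoint) =
      let F , circF , F⊆ , a∉F , b∉F =
            disjoint⇒circuit-avoiding a b circC circD v∈C v∈D disjoint
      in crossing⇒common-circuit (M₁ G) circC circD circF F⊆ a∈C a∉F b∈D b∉F

  -- If `C` left `S`, then `C ∩ S` and `C ─ S` would be proper subsets of a circuit, hence sparse.
  -- By `spread` their vertex sets are disjoint, so `C` would have at most `ν C` edges.
  circuit-connected : ∀ {C S a} → Circuit C → a ∈ C → a ∈ S →
    (∀ {e f v} → e ∈ S → Incident v e → Incident v f → f ∈ S) → C ⊆ S
  circuit-connected {C} {S} {a} circC a∈C a∈S spread {b} b∈C =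
    decidable-stable (b ∈? S) λ b∉S →
      let indX = ⊂circuit⇒independent circC (p∩q⊆p C S) b∈C λ b∈ → b∉S (p∩q⊆q C S b∈)
          indY = ⊂circuit⇒independent circC (p─q⊆p C S) a∈C (x∈q⇒x∉p─q C S a∈S)
      in ℕ.<⇒≱ (begin-strict
        ν C                      <⟨ ℕ.≤-reflexive (sym (∣circuit∣ circC)) ⟩
        ∣ C ∣                    ≤⟨ ∣p∣≤∣q∣+∣r∣ (λ {x} → split {x}) ⟩
        ∣ C ∩ S ∣ + ∣ C ─ S ∣    ≤⟨ ℕ.+-mono-≤ (independent⇒sparse indX) (independent⇒sparse indY) ⟩
        ν (C ∩ S) + ν (C ─ S)    ≤⟨ ∣p∣+∣q∣≤∣r∣ (V⟨⟩-mono G (p∩q⊆p C S)) (V⟨⟩-mono G (p─q⊆p C S)) apart ⟩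
        ν C                      ∎) ℕ.≤-refl
    where
    open ℕ.≤-Reasoning
    split : ∀ {x} → x ∈ C → x ∈ C ∩ S ⊎ x ∈ C ─ S
    split {x} x∈C with x ∈? S
    ... | yes x∈S = inj₁ (x∈p∩q⁺ (x∈C , x∈S))
    ... | no x∉S  = inj₂ (x∈p∧x∉q⇒x∈p─q x∈C x∉S)
    apart : ∀ {v} → v ∈ V (C ∩ S) → v ∉ V (C ─ S)
    apart v∈ v∈′ =
      let _ , e∈ , inc-e = V⟨⟩⁻ G v∈
          _ , f∈ , inc-f = V⟨⟩⁻ G v∈′
      in x∈q⇒x∉p─q C S (spread (p∩q⊆q C S e∈) inc-e inc-f) f∈

  -- Tight sets and coloops

  -- Inside an independent set the reverse inequality holds as well, so there tightness means as
  -- many edges as vertices.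
  Tight : Pred (Subset size) 0ℓ
  Tight X = ν X ≤ ∣ X ∣

  ⊥-tight : Tight ⊥
  ⊥-tight = subst (_≤ ∣ ⊥ {size} ∣) (sym (trans (cong ∣_∣ (Empty-unique empty)) (∣⊥∣≡0 order))) z≤n
    where
    empty : ¬ Nonempty (V ⊥)
    empty (v , v∈) = let _ , e∈ , _ = V⟨⟩⁻ G v∈ in ∉⊥ e∈

  tight-below? : ∀ Y → Decidable (λ X → X ⊆ Y × Tight X)
  tight-below? Y X = (X ⊆? Y) ×-dec (ν X ℕ.≤? ∣ X ∣)

  -- A maximal tight subset absorbs every other one, because the union of two tight subsets of `I`
  -- is tight.
  largest-tight : ∀ {I} → Independent I →
    ∃[ T ] (T ⊆ I × Tight T) × (∀ {X} → X ⊆ I → Tight X → X ⊆ T)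
  largest-tight {I} ind = from-maximal (maximal-exists (tight-below? I) (⊆-min I , ⊥-tight))
    where
    from-maximal :
      ∃[ T ] (T ⊆ I × Tight T) × (∀ {X} → X ⊆ I × Tight X → T ⊆ X → X ≡ T) →
      ∃[ T ] (T ⊆ I × Tight T) × (∀ {X} → X ⊆ I → Tight X → X ⊆ T)
    from-maximal (T , (T⊆I , tightT) , max) = T , (T⊆I , tightT) , λ {X} X⊆I tightX {x} x∈X →
      subst (x ∈_)
        (max ((λ y∈ → [ X⊆I , T⊆I ]′ (x∈p∪q⁻ X T y∈)) ,
              tight-∪ (independent-⊆ (M₁ G) T⊆I ind) tightX tightT)
             (q⊆p∪q X T))
        (p⊆p∪q T x∈X)

  -- `I` has at most as many edges as there are vertices in all, and `T` already accounts for its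
  -- own vertices.
  ∣I─T∣≤∣∁V∣ : ∀ {I T} → Independent I → T ⊆ I → Tight T → ∣ I ─ T ∣ ≤ ∣ ∁ (V T) ∣
  ∣I─T∣≤∣∁V∣ {I} {T} ind T⊆I tightT = ℕ.+-cancelʳ-≤ ∣ T ∣ _ _ (begin
    ∣ I ─ T ∣ + ∣ T ∣       ≤⟨ ∣p─q∣+∣q∣≤∣p∣ T⊆I ⟩
    ∣ I ∣                   ≤⟨ independent⇒sparse ind ⟩
    ν I                     ≤⟨ ∣p∣≤∣q∣+∣r∣ {p = V I} (λ {v} _ → split v) ⟩
    ∣ ∁ (V T) ∣ + ν T       ≤⟨ ℕ.+-monoʳ-≤ ∣ ∁ (V T) ∣ tightT ⟩
    ∣ ∁ (V T) ∣ + ∣ T ∣     ∎)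
    where
    open ℕ.≤-Reasoning
    split : ∀ v → v ∈ ∁ (V T) ⊎ v ∈ V T
    split v with v ∈? V T
    ... | yes v∈ = inj₂ v∈
    ... | no v∉  = inj₁ (x∉p⇒x∈∁p v∉)

  module _ {B e} (basisB : Basis B) (coloop : IsColoop e) where

    coloop∈basis : e ∈ B
    coloop∈basis = decidable-stable (e ∈? B) λ e∉B →
      let _ , circC , e∈C , _ = basis-∌⇒circuit (M₁ G) basisB e∉B in coloop circC e∈C

    -- An edge outside B has its ends in the tight set C - f, where C is its
    -- fundamental circuit.

    ends-in-tight : ∀ {f v} → f ∉ B → Incident v f →
      ∃[ X ] X ⊆ B - e × Tight X × v ∈ V X
    ends-in-tight {f} {v} f∉B inc = from-circuit (basis-∌⇒circuit (M₁ G) basisB f∉B)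
      where
      from-circuit : ∃[ C ] Circuit C × f ∈ C × C ⊆ B ∪ ⁅ f ⁆ →
        ∃[ X ] X ⊆ B - e × Tight X × v ∈ V X
      from-circuit (C , circC , f∈C , C⊆) = C - f ,
        (λ x∈ → x∈p∧x≢y⇒x∈p-y (C-f⊆B x∈) λ { refl → coloop circC (p─q⊆p C ⁅ f ⁆ x∈) }) ,
        ℕ.≤-trans (∣V⟨⟩∣-mono G (p─q⊆p C ⁅ f ⁆)) (circuit-minus-tight f circC) ,
        V-circuit-minus circC f∈C (V⟨⟩⁺ G (f , f∈C , inc))
        where
        C-f⊆B : C - f ⊆ B
        C-f⊆B x∈ = [ (λ x∈B → x∈B) , (λ x∈⁅f⁆ → ⊥-elim (x∈q⇒x∉p─q C ⁅ f ⁆ x∈⁅f⁆ x∈)) ]′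
          (x∈p∪q⁻ B ⁅ f ⁆ (C⊆ (p─q⊆p C ⁅ f ⁆ x∈)))

    coloop⇒sparse-cut : ∃[ W ] ∃[ Z ] e ∈ Z × ∣ Z ∣ ≤ ∣ W ∣ × Saturated W Z
    coloop⇒sparse-cut = from-tight
      (largest-tight (independent-⊆ (M₁ G) (p─q⊆p B ⁅ e ⁆) (proj₁ basisB)))
      where
      from-tight :
        ∃[ T ] (T ⊆ B - e × Tight T) × (∀ {X} → X ⊆ B - e → Tight X → X ⊆ T) →
        ∃[ W ] ∃[ Z ] e ∈ Z × ∣ Z ∣ ≤ ∣ W ∣ × Saturated W Z
      from-tight (T , (T⊆ , tightT) , largest) = ∁ (V T) , B ─ T ,
        x∈p∧x∉q⇒x∈p─q coloop∈basis (λ e∈T → x∉p-x B (T⊆ e∈T)) ,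
        ∣I─T∣≤∣∁V∣ (proj₁ basisB) (λ x∈T → p─q⊆p B ⁅ e ⁆ (T⊆ x∈T)) tightT ,
        saturated
        where
        -- An edge at `w` outside `B` would have its ends in a tight subset of `B - e`, hence in
        -- `V T`. An edge of `T` has its ends there anyway.
        saturated : Saturated (∁ (V T)) (B ─ T)
        saturated {w} {f} w∈ inc = x∈p∧x∉q⇒x∈p─q
          (decidable-stable (f ∈? B) λ f∉B →
            let X , X⊆ , tightX , w∈X = ends-in-tight f∉B inc
            in x∈∁p⇒x∉p w∈ (V⟨⟩-mono G (largest X⊆ tightX) w∈X))
          (λ f∈T → x∈∁p⇒x∉p w∈ (V⟨⟩⁺ G (f , f∈T , inc)))

  -- Ends and walks

  other-end : ∀ {u e} → Incident u e → ∃[ x ] Joins e u x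
  other-end {e = e} (inj₁ refl) = proj₂ (ends e) , inj₁ refl
  other-end {e = e} (inj₂ refl) = proj₁ (ends e) , inj₂ refl

  joins-sym : ∀ {e u v} → Joins e u v → Joins e v u
  joins-sym = Sum.swap

  joins⇒incidentˡ : ∀ {e u v} → Joins e u v → Incident u e
  joins⇒incidentˡ = Sum.map (λ eq → sym (cong proj₁ eq)) (λ eq → sym (cong proj₂ eq))

  joins⇒incidentʳ : ∀ {e u v} → Joins e u v → Incident v e
  joins⇒incidentʳ j = joins⇒incidentˡ (joins-sym j)

  joins-cover : ∀ {e u v w} → Joins e u v → Incident w e → w ≡ u ⊎ w ≡ v
  joins-cover (inj₁ eq) = Sum.map (λ p → trans p (cong proj₁ eq)) (λ p → trans p (cong proj₂ eq))
  joins-cover (inj₂ eq) = λ inc → Sum.swap (joins-cover (inj₁ eq) inc)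

  incident⇒joins : ∀ {e u v} → Incident u e → Incident v e → u ≢ v → Joins e u v
  incident⇒joins inc-u inc-v u≢v with other-end inc-u
  ... | x , j with joins-cover j inc-v
  ... | inj₁ v≡u  = ⊥-elim (u≢v (sym v≡u))
  ... | inj₂ refl = j

  incident-edge : ∀ v → ∃[ e ] Incident v e
  incident-edge v = decidable-stable (Fin.any? (incident? v)) λ none →
    noIsolated v λ e inc → none (e , inc)

  -- Counting the ends at a set of vertices

  module _ (noLeaf : ∀ v → ¬ IsLeaf v) where

    another-edge : ∀ {v e} → Incident v e → IsLink e → ∃[ f ] Incident v f × f ≢ e
    another-edge {v} {e} inc link =
      decidable-stable (Fin.any? λ f → incident? v f ×-dec ¬? (f Fin.≟ e)) λ none →
        noLeaf v (e , inc , (λ f inc-f →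
          decidable-stable (f Fin.≟ e) λ f≢e → none (f , inc-f , f≢e)) , link)

    private
      s t : Edge → Vertex
      s e = proj₁ (ends e)
      t e = proj₂ (ends e)

      -- The edges whose first, respectively second, end lies in the given set. The two sizes add up
      -- to the degree sum of that set, with loops counted twice.
      S T : Subset order → Subset size
      S = preimage s
      T = preimage t

    -- Some edge meets `w`. If it is a loop it is counted on both sides; if it is a link, `w` has a
    -- second edge because it is not a leaf.
    two-ends : ∀ w → 2 ≤ ∣ S ⁅ w ⁆ ∣ + ∣ T ⁅ w ⁆ ∣
    two-ends w = from-edge (incident-edge w)
      where
      in-S : ∀ {e} → w ≡ s e → e ∈ S ⁅ w ⁆
      in-S refl = ∈-preimage⁺ s ⁅ w ⁆ (x∈⁅x⁆ w)
      in-T : ∀ {e} → w ≡ t e → e ∈ T ⁅ w ⁆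
      in-T refl = ∈-preimage⁺ t ⁅ w ⁆ (x∈⁅x⁆ w)
      both : ∀ {e f} → w ≡ s e → w ≡ t f → 2 ≤ ∣ S ⁅ w ⁆ ∣ + ∣ T ⁅ w ⁆ ∣
      both we wf = ℕ.+-mono-≤ (x∈p⇒1≤∣p∣ (in-S we)) (x∈p⇒1≤∣p∣ (in-T wf))
      from-two : ∀ {e f} → Incident w e → Incident w f → f ≢ e → 2 ≤ ∣ S ⁅ w ⁆ ∣ + ∣ T ⁅ w ⁆ ∣
      from-two (inj₁ we) (inj₂ wf) _ = both we wf
      from-two (inj₂ we) (inj₁ wf) _ = both wf we
      from-two (inj₁ we) (inj₁ wf) f≢e =
        ℕ.≤-trans (x≢y⇒2≤∣p∣ (in-S wf) (in-S we) f≢e) (ℕ.m≤m+n _ _)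
      from-two (inj₂ we) (inj₂ wf) f≢e =
        ℕ.≤-trans (x≢y⇒2≤∣p∣ (in-T wf) (in-T we) f≢e) (ℕ.m≤n+m _ _)
      from-edge : ∃[ e ] Incident w e → 2 ≤ ∣ S ⁅ w ⁆ ∣ + ∣ T ⁅ w ⁆ ∣
      from-edge (e , inc) with s e Fin.≟ t e | inc
      ... | yes loop | inj₁ we = both we (trans we loop)
      ... | yes loop | inj₂ we = both (trans we (sym loop)) we
      ... | no link  | _ = let f , inc-f , f≢e = another-edge inc link in from-two inc inc-f f≢e

    -- Sums `two-ends` over `W`, one vertex at a time; the preimages of distinct vertices are
    -- disjoint.
    2∣W∣≤ends : ∀ W → ∣ W ∣ + ∣ W ∣ ≤ ∣ S W ∣ + ∣ T W ∣
    2∣W∣≤ends W = go (⊂-wellFounded W)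
      where
      open ℕ.≤-Reasoning
      interchange : ∀ a b c d → (a + b) + (c + d) ≡ (a + c) + (b + d)
      interchange a b c d = begin-equality
        (a + b) + (c + d)    ≡⟨ ℕ.+-assoc a b (c + d) ⟩
        a + (b + (c + d))    ≡⟨ cong (a +_) (ℕ.+-assoc b c d) ⟨
        a + ((b + c) + d)    ≡⟨ cong (λ x → a + (x + d)) (ℕ.+-comm b c) ⟩
        a + ((c + b) + d)    ≡⟨ cong (a +_) (ℕ.+-assoc c b d) ⟩
        a + (c + (b + d))    ≡⟨ ℕ.+-assoc a c (b + d) ⟨
        (a + c) + (b + d)    ∎
      split : ∀ {W w} (f : Edge → Vertex) → w ∈ W →
        ∣ preimage f ⁅ w ⁆ ∣ + ∣ preimage f (W - w) ∣ ≤ ∣ preimage f W ∣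
      split {W} {w} f w∈W = ∣p∣+∣q∣≤∣r∣
        (λ e∈ → ∈-preimage⁺ f W (⁅x⁆⊆p w∈W (∈-preimage⁻ f ⁅ w ⁆ e∈)))
        (λ e∈ → ∈-preimage⁺ f W (p─q⊆p W ⁅ w ⁆ (∈-preimage⁻ f (W - w) e∈)))
        (λ e∈ e∈′ → x∈q⇒x∉p─q W ⁅ w ⁆ (∈-preimage⁻ f ⁅ w ⁆ e∈) (∈-preimage⁻ f (W - w) e∈′))
      go : ∀ {W} → Acc _⊂_ W → ∣ W ∣ + ∣ W ∣ ≤ ∣ S W ∣ + ∣ T W ∣
      go {W} (acc rec) with nonempty? W
      ... | no empty = subst (λ n → n + n ≤ ∣ S W ∣ + ∣ T W ∣)
        (sym (trans (cong ∣_∣ (Empty-unique empty)) (∣⊥∣≡0 order))) z≤n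
      ... | yes (w , w∈W) = begin
        ∣ W ∣ + ∣ W ∣                        ≤⟨ ℕ.+-mono-≤ (∣p∣≤1+∣p-x∣ W w) (∣p∣≤1+∣p-x∣ W w) ⟩
        (1 + ∣ W - w ∣) + (1 + ∣ W - w ∣)    ≡⟨ interchange 1 _ 1 _ ⟩
        2 + (∣ W - w ∣ + ∣ W - w ∣)          ≤⟨ ℕ.+-mono-≤ (two-ends w) (go (rec (x∈p⇒p-x⊂p w∈W))) ⟩
        (∣ S ⁅ w ⁆ ∣ + ∣ T ⁅ w ⁆ ∣) + (∣ S (W - w) ∣ + ∣ T (W - w) ∣)
                                             ≡⟨ interchange ∣ S ⁅ w ⁆ ∣ _ _ _ ⟩
        (∣ S ⁅ w ⁆ ∣ + ∣ S (W - w) ∣) + (∣ T ⁅ w ⁆ ∣ + ∣ T (W - w) ∣)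
                                             ≤⟨ ℕ.+-mono-≤ (split s w∈W) (split t w∈W) ⟩
        ∣ S W ∣ + ∣ T W ∣                    ∎

    -- `S W` and `T W` are subsets of `Z`, but together they have at least twice as many elements as
    -- `W`, hence as `Z`. So both equal `Z`.
    saturated⇒ends∈ : ∀ {W Z} → Saturated W Z → ∣ Z ∣ ≤ ∣ W ∣ →
      ∀ {e v} → e ∈ Z → Incident v e → v ∈ W
    saturated⇒ends∈ {W} {Z} sat ∣Z∣≤∣W∣ {e} e∈Z =
      [ (λ { refl → ∈-preimage⁻ s W (⊆∧∣q∣≤∣p∣⇒⊇ S⊆Z Z≤S e∈Z) }) ,
        (λ { refl → ∈-preimage⁻ t W (⊆∧∣q∣≤∣p∣⇒⊇ T⊆Z Z≤T e∈Z) }) ]′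
      where
      open ℕ.≤-Reasoning
      S⊆Z : S W ⊆ Z
      S⊆Z f∈ = sat (∈-preimage⁻ s W f∈) (inj₁ refl)
      T⊆Z : T W ⊆ Z
      T⊆Z f∈ = sat (∈-preimage⁻ t W f∈) (inj₂ refl)
      Z≤S : ∣ Z ∣ ≤ ∣ S W ∣
      Z≤S = ℕ.+-cancelʳ-≤ ∣ Z ∣ _ _ (begin
        ∣ Z ∣ + ∣ Z ∣        ≤⟨ ℕ.+-mono-≤ ∣Z∣≤∣W∣ ∣Z∣≤∣W∣ ⟩
        ∣ W ∣ + ∣ W ∣        ≤⟨ 2∣W∣≤ends W ⟩
        ∣ S W ∣ + ∣ T W ∣    ≤⟨ ℕ.+-monoʳ-≤ ∣ S W ∣ (p⊆q⇒∣p∣≤∣q∣ T⊆Z) ⟩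
        ∣ S W ∣ + ∣ Z ∣      ∎)
      Z≤T : ∣ Z ∣ ≤ ∣ T W ∣
      Z≤T = ℕ.+-cancelˡ-≤ ∣ Z ∣ _ _ (begin
        ∣ Z ∣ + ∣ Z ∣        ≤⟨ ℕ.+-mono-≤ ∣Z∣≤∣W∣ ∣Z∣≤∣W∣ ⟩
        ∣ W ∣ + ∣ W ∣        ≤⟨ 2∣W∣≤ends W ⟩
        ∣ S W ∣ + ∣ T W ∣    ≤⟨ ℕ.+-monoˡ-≤ ∣ T W ∣ (p⊆q⇒∣p∣≤∣q∣ S⊆Z) ⟩
        ∣ Z ∣ + ∣ T W ∣      ∎)

  incident∈walk : ∀ {u w} (p : Walk G u w) {e v} → e List.∈ edges G p → Incident v e →
    v List.∈ u ∷ laterVertices G p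
  incident∈walk (e via j ∷ p) (here refl) inc with joins-cover j inc
  ... | inj₁ refl = here refl
  ... | inj₂ refl = there (here refl)
  incident∈walk (e via j ∷ p) (there e∈) inc = there (incident∈walk p e∈ inc)

  -- A second occurrence of the first edge would make its end `u` a later vertex.
  path-unique-edges : ∀ {u w} (p : Walk G u w) → Unique (u ∷ laterVertices G p) → Unique (edges G p)
  path-unique-edges [] _ = []
  path-unique-edges (e via j ∷ p) (u∉ ∷ unique) =
    ¬Any⇒All¬ _ (λ e∈p → All¬⇒¬Any u∉ (incident∈walk p e∈p (joins⇒incidentˡ j))) ∷
    path-unique-edges p unique

  -- Used to cut a path where it closes up to a cycle, and to reach each vertex of a cycle from its
  -- starting point.
  prefix : ∀ {u w x} (p : Walk G u w) → x List.∈ u ∷ laterVertices G p →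
    Unique (laterVertices G p) →
    Σ (Walk G u x) λ q → (∀ {e} → e List.∈ edges G q → e List.∈ edges G p) ×
      (∀ {v} → v List.∈ laterVertices G q → v List.∈ laterVertices G p) ×
      Unique (laterVertices G q)
  prefix p (here refl) _ = [] , (λ ()) , (λ ()) , []
  prefix (e via j ∷ p) (there x∈) (v∉ ∷ unique) with prefix p x∈ unique
  ... | q , edges⊆ , later⊆ , unique′ = (e via j ∷ q) ,
    (λ { (here refl) → here refl ; (there e∈) → there (edges⊆ e∈) }) ,
    (λ { (here refl) → here refl ; (there v∈) → there (later⊆ v∈) }) ,
    (anti-mono later⊆ v∉ ∷ unique′)

  last∈later : ∀ {u w} (p : Walk G u w) → edges G p ≢ [] → w List.∈ laterVertices G p
  last∈later [] ne = ⊥-elim (ne refl)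
  last∈later (e via j ∷ []) _ = here refl
  last∈later (e via j ∷ p@(_ via _ ∷ _)) _ = there (last∈later p λ ())

  length-edges : ∀ {u w} (p : Walk G u w) → length (edges G p) ≡ length (laterVertices G p)
  length-edges []            = refl
  length-edges (_ via _ ∷ p) = cong suc (length-edges p)

  Reach : Subset size → Vertex → Vertex → Set
  Reach X u v = Σ (Walk G u v) λ p → All (_∈ X) (edges G p)

  module _ {X : Subset size} where

    reach-edge : ∀ {e u v} → e ∈ X → Joins e u v → Reach X u v
    reach-edge {e} e∈X j = (e via j ∷ []) , (e∈X ∷ [])

    reach-trans : ∀ {u v w} → Reach X u v → Reach X v w → Reach X u w
    reach-trans ([] , []) r = r
    reach-trans ((e via j ∷ p) , (e∈X ∷ p∈X)) r =
      let q , q∈X = reach-trans (p , p∈X) r in (e via j ∷ q) , (e∈X ∷ q∈X)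

    reach-sym : ∀ {u v} → Reach X u v → Reach X v u
    reach-sym ([] , []) = [] , []
    reach-sym ((e via j ∷ p) , (e∈X ∷ p∈X)) =
      reach-trans (reach-sym (p , p∈X)) (reach-edge e∈X (joins-sym j))

  -- Components

  open Subgraph

  saturated-walk : ∀ {W Z u w} → Saturated W Z → (∀ {e v} → e ∈ Z → Incident v e → v ∈ W) →
    u ∈ W → (p : Walk G u w) → w ∈ W × All (_∈ Z) (edges G p)
  saturated-walk sat closedZ u∈W [] = u∈W , []
  saturated-walk sat closedZ u∈W (e via j ∷ p) =
    let e∈Z = sat u∈W (joins⇒incidentˡ j)
        w∈W , p∈Z = saturated-walk sat closedZ (closedZ e∈Z (joins⇒incidentʳ j)) p
    in w∈W , (e∈Z ∷ p∈Z)

  -- Walks in `G` suffice: a walk that starts in `H` cannot leave it. For the same reason a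
  -- connected subgraph containing `H` has no further vertices.
  saturated⇒component : (H : Subgraph G) → Saturated (verts H) (edgs H) → ∀ {r} → r ∈ verts H →
    (∀ {u} → u ∈ verts H → Walk G r u) → IsComponent G H
  saturated⇒component H sat {r} r∈H walk = ((r , r∈H) , connected) , maximal
    where
    from-root : ∀ {u} → u ∈ verts H → Reach (edgs H) r u
    from-root u∈H = walk u∈H , proj₂ (saturated-walk sat (closed H) r∈H (walk u∈H))
    connected : ∀ {u v} → u ∈ verts H → v ∈ verts H → Reach (edgs H) u v
    connected u∈H v∈H = reach-trans (reach-sym (from-root u∈H)) (from-root v∈H)
    maximal : ∀ K → Connected G K → _≼_ G H K → _≼_ G K H
    maximal K (_ , conK) (vH⊆ , _) = verts⊆ , λ e∈K →
      sat (verts⊆ (closed K e∈K (inj₁ refl))) (inj₁ refl)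
      where
      verts⊆ : verts K ⊆ verts H
      verts⊆ x∈K = proj₁ (saturated-walk sat (closed H) r∈H (proj₁ (conK (vH⊆ r∈H) x∈K)))

  -- Adding `e` and its other end `x` to `A` keeps it connected, so by maximality they are already
  -- in `A`.
  component⇒saturated : (A : Subgraph G) → IsComponent G A → Saturated (verts A) (edgs A)
  component⇒saturated A (((r , r∈A) , conA) , maxA) {u} {e} u∈A inc =
    proj₂ (maxA K ((u , v⊆ u∈A) , connected) (v⊆ , e⊆)) (q⊆p∪q (edgs A) _ (x∈⁅x⁆ e))
    where
    x = proj₁ (other-end inc)
    j : Joins e u x
    j = proj₂ (other-end inc)
    v⊆ : verts A ⊆ verts A ∪ ⁅ x ⁆
    v⊆ = p⊆p∪q ⁅ x ⁆
    e⊆ : edgs A ⊆ edgs A ∪ ⁅ e ⁆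
    e⊆ = p⊆p∪q ⁅ e ⁆
    closedK : ∀ {v f} → f ∈ edgs A ∪ ⁅ e ⁆ → Incident v f → v ∈ verts A ∪ ⁅ x ⁆
    closedK f∈ inc-f with x∈p∪q⁻ (edgs A) ⁅ e ⁆ f∈
    ... | inj₁ f∈A = v⊆ (closed A f∈A inc-f)
    ... | inj₂ f∈⁅e⁆ with x∈⁅y⁆⇒x≡y e f∈⁅e⁆
    ... | refl with joins-cover j inc-f
    ... | inj₁ refl = v⊆ u∈A
    ... | inj₂ refl = q⊆p∪q (verts A) ⁅ x ⁆ (x∈⁅x⁆ x)
    K : Subgraph G
    K = record { verts = verts A ∪ ⁅ x ⁆ ; edgs = edgs A ∪ ⁅ e ⁆ ; closed = closedK }
    from-u : ∀ {w} → w ∈ verts K → Reach (edgs K) u w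
    from-u w∈ with x∈p∪q⁻ (verts A) ⁅ x ⁆ w∈
    ... | inj₁ w∈A = let p , p∈A = conA u∈A w∈A in p , All.map e⊆ p∈A
    ... | inj₂ w∈⁅x⁆ = subst (Reach _ u) (sym (x∈⁅y⁆⇒x≡y x w∈⁅x⁆))
      (reach-edge (q⊆p∪q (edgs A) ⁅ e ⁆ (x∈⁅x⁆ e)) j)
    connected : ∀ {v w} → v ∈ verts K → w ∈ verts K → Reach (edgs K) v w
    connected v∈ w∈ = reach-trans (reach-sym (from-u v∈)) (from-u w∈)

  -- Grow the vertex set from `r`, keeping walks from `r`, until no edge leaves it.
  component-of : ∀ r → ∃[ A ] IsComponent G A × r ∈ verts A
  component-of r = go (⊃-wellFounded ⁅ r ⁆) (x∈⁅x⁆ r) λ u∈ →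
    subst (Walk G r) (sym (x∈⁅y⁆⇒x≡y r u∈)) []
    where
    Crossing : Subset order → Set
    Crossing S = ∃[ e ] ∃[ u ] ∃[ x ] (Incident u e × u ∈ S) × (Incident x e × x ∉ S)
    crossing? : ∀ S → Dec (Crossing S)
    crossing? S = Fin.any? λ e → Fin.any? λ u → Fin.any? λ x →
      (incident? u e ×-dec (u ∈? S)) ×-dec (incident? x e ×-dec ¬? (x ∈? S))
    snoc : ∀ {u v w e} → Walk G u v → Joins e v w → Walk G u w
    snoc []              j = _ via j ∷ []
    snoc (e via j′ ∷ p)  j = e via j′ ∷ snoc p j
    go : ∀ {S} → Acc _⊃_ S → r ∈ S → (∀ {u} → u ∈ S → Walk G r u) →
      ∃[ A ] IsComponent G A × r ∈ verts A
    go {S} (acc rec) r∈S walk with crossing? S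
    ... | yes (e , u , x , (inc-u , u∈S) , (inc-x , x∉S)) =
      go (rec (p⊆p∪q ⁅ x ⁆ , x , x∈ , x∉S)) (p⊆p∪q ⁅ x ⁆ r∈S) walk′
      where
      x∈ : x ∈ S ∪ ⁅ x ⁆
      x∈ = q⊆p∪q S ⁅ x ⁆ (x∈⁅x⁆ x)
      walk′ : ∀ {w} → w ∈ S ∪ ⁅ x ⁆ → Walk G r w
      walk′ w∈ with x∈p∪q⁻ S ⁅ x ⁆ w∈
      ... | inj₁ w∈S = walk w∈S
      ... | inj₂ w∈⁅x⁆ = subst (Walk G r) (sym (x∈⁅y⁆⇒x≡y x w∈⁅x⁆))
        (snoc (walk u∈S) (incident⇒joins inc-u inc-x λ { refl → x∉S u∈S }))
    ... | no none = A , saturated⇒component A sat r∈S walk , r∈S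
      where
      spread : ∀ {e u x} → Incident u e → u ∈ S → Incident x e → x ∈ S
      spread {e} {u} {x} inc-u u∈S inc-x = decidable-stable (x ∈? S) λ x∉S →
        none (e , u , x , (inc-u , u∈S) , (inc-x , x∉S))
      A : Subgraph G
      A = record
        { verts  = S
        -- As no edge crosses `S`, testing the first end alone selects every edge that meets `S`.
        ; edgs   = preimage (proj₁ ∘ ends) S
        ; closed = λ e∈ inc → spread (inj₁ refl) (∈-preimage⁻ (proj₁ ∘ ends) S e∈) inc
        }
      sat : Saturated (verts A) (edgs A)
      sat u∈S inc = ∈-preimage⁺ (proj₁ ∘ ends) S (spread inc u∈S (inj₁ refl))

  -- Cycles

  -- Each edge is charged to a vertex that the walk enters through it. The intersection with the
  -- later vertices is what carries the induction: the vertex entered first does not recur, so it is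
  -- new when the first edge is in `X`. For a cycle this says that no set of its edges has more
  -- edges than vertices.
  walk-sparse : ∀ {u w} (p : Walk G u w) → Unique (laterVertices G p) → ∀ {X} →
    (∀ {e} → e ∈ X → e List.∈ edges G p) → ∣ X ∣ ≤ ∣ V X ∩ fromList (laterVertices G p) ∣
  walk-sparse [] _ {X} X⊆ = subst (_≤ ∣ V X ∩ ⊥ ∣)
    (sym (trans (cong ∣_∣ (Empty-unique empty)) (∣⊥∣≡0 size))) z≤n
    where
    empty : ¬ Nonempty X
    empty (e , e∈X) with X⊆ e∈X
    ... | ()
  walk-sparse (_via_∷_ {v = v} e j p) (v∉ ∷ unique) {X} X⊆ = by-cases (e ∈? X)
    where
    open ℕ.≤-Reasoning
    L = fromList (laterVertices G p)
    shrink : ∀ {Y} → Y ⊆ X → V Y ∩ L ⊆ V X ∩ (⁅ v ⁆ ∪ L)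
    shrink {Y} Y⊆X x∈ = let x∈V , x∈L = x∈p∩q⁻ (V Y) L x∈ in
      x∈p∩q⁺ (V⟨⟩-mono G Y⊆X x∈V , q⊆p∪q ⁅ v ⁆ L x∈L)
    tail : ∀ {f} → f ∈ X → f ≢ e → f List.∈ edges G p
    tail f∈X f≢e with X⊆ f∈X
    ... | here f≡e = ⊥-elim (f≢e f≡e)
    ... | there f∈ = f∈
    by-cases : Dec (e ∈ X) → ∣ X ∣ ≤ ∣ V X ∩ (⁅ v ⁆ ∪ L) ∣
    by-cases (no e∉X) = begin
      ∣ X ∣                         ≤⟨ walk-sparse p unique (λ f∈X → tail f∈X λ { refl → e∉X f∈X }) ⟩
      ∣ V X ∩ L ∣                   ≤⟨ p⊆q⇒∣p∣≤∣q∣ (shrink λ x∈X → x∈X) ⟩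
      ∣ V X ∩ (⁅ v ⁆ ∪ L) ∣         ∎
    by-cases (yes e∈X) = begin
      ∣ X ∣                         ≤⟨ ∣p∣≤1+∣p-x∣ X e ⟩
      suc ∣ X - e ∣                 ≤⟨ s≤s (walk-sparse p unique λ f∈ →
        tail (p─q⊆p X ⁅ e ⁆ f∈) λ { refl → x∉p-x X f∈ }) ⟩
      suc ∣ V (X - e) ∩ L ∣         ≤⟨ p⊂q⇒∣p∣<∣q∣ (shrink (p─q⊆p X ⁅ e ⁆) , v ,
        x∈p∩q⁺ (V⟨⟩⁺ G (e , e∈X , joins⇒incidentʳ j) , p⊆p∪q L (x∈⁅x⁆ v)) ,
        λ v∈ → All¬⇒¬Any v∉ (∈-fromList⁻ _ (proj₂ (x∈p∩q⁻ (V (X - e)) L v∈)))) ⟩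
      ∣ V X ∩ (⁅ v ⁆ ∪ L) ∣         ∎

  module _ (noLeaf : ∀ v → ¬ IsLeaf v) where

    -- Extend a path backwards until it meets itself.

    cycle-within : ∀ {W r} → (∀ {u v e} → u ∈ W → Incident u e → Incident v e → v ∈ W) → r ∈ W →
      ∃[ x ] Σ (Walk G x x) λ p → edges G p ≢ [] × Unique (edges G p) ×
        Unique (laterVertices G p) × All (_∈ W) (laterVertices G p)
    cycle-within {W} {r} spread r∈W = go [] (⊃-wellFounded _) ([] ∷ []) (r∈W ∷ [])
      where
      open DecList Fin._≟_ using () renaming (_∈?_ to _∈ˡ?_)

      -- On a nonempty path the first edge is a link, as `u` differs from the next vertex. So a
      -- second edge at `u` exists, and no later edge of the path meets `u`.
      fresh-edge : ∀ {u w} (p : Walk G u w) → Unique (u ∷ laterVertices G p) →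
        ∃[ f ] Incident u f × ¬ (f List.∈ edges G p)
      fresh-edge {u} [] _ = let f , inc = incident-edge u in f , inc , λ ()
      fresh-edge {u} (e via j ∷ p) (u∉@(u≢v ∷ _) ∷ _) =
        let f , inc , f≢e = another-edge noLeaf (joins⇒incidentˡ j) link in f , inc , λ
          { (here f≡e)  → f≢e f≡e
          ; (there f∈p) → All¬⇒¬Any u∉ (incident∈walk p f∈p inc) }
        where
        link : IsLink e
        link = case j
          where
          case : Joins e _ _ → IsLink e
          case (inj₁ eq) loop = u≢v (trans (sym (cong proj₁ eq)) (trans loop (cong proj₂ eq)))
          case (inj₂ eq) loop = u≢v (trans (sym (cong proj₂ eq)) (trans (sym loop) (cong proj₁ eq)))

      Result : Set
      Result = ∃[ x ] Σ (Walk G x x) λ p → edges G p ≢ [] × Unique (edges G p) ×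
        Unique (laterVertices G p) × All (_∈ W) (laterVertices G p)

      go : ∀ {u w} (p : Walk G u w) → Acc _⊃_ (fromList (u ∷ laterVertices G p)) →
        Unique (u ∷ laterVertices G p) → All (_∈ W) (u ∷ laterVertices G p) → Result
      go {u} p (acc rec) unique@(u∉ ∷ unique′) in-W@(u∈W ∷ later∈W) =
        let f , inc , f∉p = fresh-edge p unique
            x , j = other-end inc
        in extend f∉p j (x ∈ˡ? (u ∷ laterVertices G p))
        where
        extend : ∀ {f x} → ¬ (f List.∈ edges G p) → Joins f u x →
          Dec (x List.∈ u ∷ laterVertices G p) → Result
        extend {f} {x} _ j (no x∉) = go (f via joins-sym j ∷ p)
          (rec (q⊆p∪q ⁅ x ⁆ _ , x , p⊆p∪q _ (x∈⁅x⁆ x) , λ x∈ → x∉ (∈-fromList⁻ _ x∈)))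
          (¬Any⇒All¬ _ x∉ ∷ unique)
          (spread u∈W (joins⇒incidentˡ j) (joins⇒incidentʳ j) ∷ in-W)
        -- The cycle goes along `f` from `x` to `u` and back to `x` along the path. If `f` is a
        -- loop, the way back is empty.
        extend {f} {x} f∉p j (yes x∈) with prefix p x∈ unique′
        ... | q , edges⊆ , later⊆ , unique-q =
          x , (f via joins-sym j ∷ q) , (λ ()) ,
          (¬Any⇒All¬ _ (λ f∈q → f∉p (edges⊆ f∈q)) ∷ path-unique-edges q unique-uq) ,
          unique-uq , (u∈W ∷ anti-mono later⊆ later∈W)
          where
          unique-uq : Unique (u ∷ laterVertices G q)
          unique-uq = anti-mono later⊆ u∉ ∷ unique-q

    -- Removing the cycle leaves a sparse cut, whose edges have both ends off the
    -- cycle; so no further edge meets it.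

    sparse-cut⇒cycle-component : ∀ {W Z e} → Saturated W Z → ∣ Z ∣ ≤ ∣ W ∣ → e ∈ Z →
      ∃[ A ] IsComponent G A × IsCycle G A
    sparse-cut⇒cycle-component {W} {Z} sat ∣Z∣≤∣W∣ e∈Z =
      from-cycle (cycle-within spread (ends∈ e∈Z (inj₁ refl)))
      where
      ends∈ : ∀ {e v} → e ∈ Z → Incident v e → v ∈ W
      ends∈ = saturated⇒ends∈ noLeaf sat ∣Z∣≤∣W∣
      spread : ∀ {u v e} → u ∈ W → Incident u e → Incident v e → v ∈ W
      spread u∈W inc-u = ends∈ (sat u∈W inc-u)
      from-cycle : ∃[ x ] Σ (Walk G x x) (λ p → edges G p ≢ [] × Unique (edges G p) ×
        Unique (laterVertices G p) × All (_∈ W) (laterVertices G p)) →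
        ∃[ A ] IsComponent G A × IsCycle G A
      from-cycle (x , p , p≢[] , unique-e , unique-v , later∈W) = A ,
        saturated⇒component A satA (∈-fromList⁺ x∈p)
          (λ u∈U → proj₁ (prefix p (there (∈-fromList⁻ _ u∈U)) unique-v)) ,
        x , p , p≢[] , unique-e , unique-v ,
        (λ e → mk⇔ (∈-fromList⁻ _) ∈-fromList⁺) , (λ v → mk⇔ (∈-fromList⁻ _) ∈-fromList⁺)
        where
        open ℕ.≤-Reasoning
        Q = fromList (edges G p)
        U = fromList (laterVertices G p)
        x∈p : x List.∈ laterVertices G p
        x∈p = last∈later p p≢[]
        closedA : ∀ {v e} → e ∈ Q → Incident v e → v ∈ U
        closedA e∈Q inc with incident∈walk p (∈-fromList⁻ _ e∈Q) inc
        ... | here refl = ∈-fromList⁺ x∈p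
        ... | there v∈  = ∈-fromList⁺ v∈
        A : Subgraph G
        A = record { verts = U ; edgs = Q ; closed = closedA }
        U⊆W : U ⊆ W
        U⊆W v∈U = All.lookup later∈W (∈-fromList⁻ _ v∈U)
        Q⊆Z : Q ⊆ Z
        Q⊆Z e∈Q = sat (U⊆W (closedA e∈Q (inj₁ refl))) (inj₁ refl)
        sat′ : Saturated (W ─ U) (Z ─ Q)
        sat′ w∈ inc = x∈p∧x∉q⇒x∈p─q (sat (p─q⊆p W U w∈) inc) λ e∈Q →
          x∈q⇒x∉p─q W U (closedA e∈Q inc) w∈
        ∣Q∣≥∣U∣ : ∣ U ∣ ≤ ∣ Q ∣
        ∣Q∣≥∣U∣ = begin
          ∣ U ∣                           ≤⟨ ∣fromList∣≤length (laterVertices G p) ⟩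
          length (laterVertices G p)      ≡⟨ length-edges p ⟨
          length (edges G p)              ≤⟨ length≤∣fromList∣ unique-e ⟩
          ∣ Q ∣                           ∎
        ∣Z─Q∣≤∣W─U∣ : ∣ Z ─ Q ∣ ≤ ∣ W ─ U ∣
        ∣Z─Q∣≤∣W─U∣ = ℕ.+-cancelʳ-≤ ∣ Q ∣ _ _ (begin
          ∣ Z ─ Q ∣ + ∣ Q ∣     ≤⟨ ∣p─q∣+∣q∣≤∣p∣ Q⊆Z ⟩
          ∣ Z ∣                 ≤⟨ ∣Z∣≤∣W∣ ⟩
          ∣ W ∣                 ≤⟨ ∣p∣≤∣p─q∣+∣q∣ {p = W} {U} ⟩
          ∣ W ─ U ∣ + ∣ U ∣     ≤⟨ ℕ.+-monoʳ-≤ ∣ W ─ U ∣ ∣Q∣≥∣U∣ ⟩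
          ∣ W ─ U ∣ + ∣ Q ∣     ∎)
        satA : Saturated U Q
        -- An edge at `U` outside `Q` lies in `Z ─ Q`, which would put its end `u` in `W ─ U`.
        satA {e = e} u∈U inc = decidable-stable (e ∈? Q) λ e∉Q →
          x∈q⇒x∉p─q W U u∈U (saturated⇒ends∈ noLeaf sat′ ∣Z─Q∣≤∣W─U∣
            (x∈p∧x∉q⇒x∈p─q (sat (U⊆W u∈U) inc) e∉Q) inc)

  -- Cacti-graphs and the classes of ∼

  ¬coloop⇒circuit : ∀ {e} → ¬ IsColoop e → ∃[ C ] Circuit C × e ∈ C
  ¬coloop⇒circuit {e} ¬coloop =
    decidable-stable (anySubset? λ C → circuit? C ×-dec (e ∈? C)) λ none →
      ¬coloop λ circC e∈C → none (_ , circC , e∈C)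

  -- Consecutive edges in the sequence from `a` along the walk to `b` share a vertex, so the common
  -- circuit is carried along from the far end.
  walk⇒common-circuit : (∀ e → ∃[ C ] Circuit C × e ∈ C) → ∀ {u w a b} → Walk G u w →
    Incident u a → Incident w b → ∃[ C ] Circuit C × a ∈ C × b ∈ C
  walk⇒common-circuit circuit [] inc-a inc-b =
    let _ , circC , a∈C = circuit _
        _ , circD , b∈D = circuit _
    in common-vertex⇒common-circuit circC circD
         (V⟨⟩⁺ G (_ , a∈C , inc-a)) (V⟨⟩⁺ G (_ , b∈D , inc-b)) a∈C b∈D
  walk⇒common-circuit circuit (e via j ∷ p) inc-a inc-b =
    let _ , circC , a∈C = circuit _
        _ , circD , e∈D , b∈D = walk⇒common-circuit circuit p (joins⇒incidentʳ j) inc-b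
    in common-vertex⇒common-circuit circC circD
         (V⟨⟩⁺ G (_ , a∈C , inc-a)) (V⟨⟩⁺ G (_ , e∈D , joins⇒incidentˡ j)) a∈C b∈D

  module _ (cacti : IsCactiGraph G) where

    cacti⇒circuit : ∀ e → ∃[ C ] Circuit C × e ∈ C
    cacti⇒circuit e = ¬coloop⇒circuit λ coloop →
      let _ , basisB = basis-exists (M₁ G)
          W , Z , e∈Z , ∣Z∣≤∣W∣ , sat = coloop⇒sparse-cut basisB coloop
          A , comp , cycle =
            sparse-cut⇒cycle-component (proj₁ (proj₂ cacti)) sat ∣Z∣≤∣W∣ e∈Z
      in proj₂ (proj₂ cacti) A comp cycle

    cacti⇒class : ∀ A → IsComponent G A → IsEquivalenceClass (edgs A)
    cacti⇒class A comp@(((v , v∈A) , connected) , _) = a ,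
      ∈circuit⇒Proper (proj₁ (proj₂ (cacti⇒circuit a))) (proj₂ (proj₂ (cacti⇒circuit a))) ,
      λ b → mk⇔ (to b) (from b)
      where
      satA : Saturated (verts A) (edgs A)
      satA = component⇒saturated A comp
      a = proj₁ (incident-edge v)
      inc-a : Incident v a
      inc-a = proj₂ (incident-edge v)
      a∈A : a ∈ edgs A
      a∈A = satA v∈A inc-a
      to : ∀ b → b ∈ edgs A → Proper b × a ∼ b
      to b b∈A =
        let C , circC , a∈C , b∈C = walk⇒common-circuit cacti⇒circuit
              (proj₁ (connected v∈A (closed A b∈A (inj₁ refl)))) inc-a (inj₁ refl)
        in ∈circuit⇒Proper circC b∈C , inj₂ (C , circC , a∈C , b∈C)
      from : ∀ b → Proper b × a ∼ b → b ∈ edgs A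
      from b (_ , inj₁ refl) = a∈A
      -- A circuit cannot leave a component: the edges of `A` contain every edge that shares a
      -- vertex with one of them.
      from b (_ , inj₂ (C , circC , a∈C , b∈C)) = circuit-connected circC a∈C a∈A
        (λ e∈A inc-e inc-f → satA (closed A e∈A inc-e) inc-f) b∈C

  module _ (class : ∀ A → IsComponent G A → IsEquivalenceClass (edgs A)) where

    -- The representative of the class is not a coloop, so it lies in a circuit, and all elements of
    -- that circuit belong to its class.
    component⇒circuit : ∀ A → IsComponent G A →
      ∃[ C ] Circuit C × Nonempty C × C ⊆ edgs A
    component⇒circuit A comp with class A comp
    ... | a , proper , a∼ =
      let C , circC , a∈C = ¬coloop⇒circuit (λ coloop → proper (inj₂ coloop))
      in C , circC , (a , a∈C) , λ c∈C →
        Equivalence.from (a∼ _) (∈circuit⇒Proper circC c∈C , inj₂ (C , circC , a∈C , c∈C))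

    class⇒nonTrivial : NonTrivial
    class⇒nonTrivial =
      -- A vertex exists because `order` is nonzero, so there is a component to apply `class` to.
      let A , comp , _ = component-of (fromℕ< (>-nonZero⁻¹ order))
          C , circC , (a , _) , _ = component⇒circuit A comp
      in (C , circC) , cocircuit-exists (M₁ G) (⁅e⁆-independent a)

    class⇒noLeaf : ∀ v → ¬ IsLeaf v
    class⇒noLeaf v (e , inc , only , _) =
      let A , comp , v∈A = component-of v
          _ , _ , a∼ = class A comp
          proper , _ = Equivalence.to (a∼ e) (component⇒saturated A comp v∈A inc)
          C , circC , e∈C = ¬coloop⇒circuit (λ coloop → proper (inj₂ coloop))
          -- The vertex `v` is still met by an edge of `C - e`, but `e` is the only edge at a leaf.
          f , f∈ , inc-f = V⟨⟩⁻ G (V-circuit-minus circC e∈C (V⟨⟩⁺ G (e , e∈C , inc)))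
      in x∉p-x C (subst (_∈ C - e) (only f inc-f) f∈)

    class⇒noCycle : ∀ A → IsComponent G A → ¬ IsCycle G A
    class⇒noCycle A comp (_ , p , _ , _ , unique , e∈⇔ , _) =
      let C , circC , _ , C⊆A = component⇒circuit A comp in
      ℕ.<⇒≱ (ℕ.≤-reflexive (sym (∣circuit∣ circC)))
        (ℕ.≤-trans (walk-sparse p unique λ c∈C → Equivalence.to (e∈⇔ _) (C⊆A c∈C))
                   (∣p∩q∣≤∣p∣ (V C) _))

mainTheorem14 : (G : Graph) →
    (Matroid.NonTrivial (M₁ G) × IsCactiGraph G)
    ⇔ ((A : Subgraph G) → IsComponent G A →
        Matroid.IsEquivalenceClass (M₁ G) (Subgraph.edgs A))
mainTheorem14 G = mk⇔
  (λ (_ , cacti) → cacti⇒class G cacti)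
  (λ class → class⇒nonTrivial G class ,
    Graph.noIsolated G , class⇒noLeaf G class , class⇒noCycle G class)
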